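{- Let $n\in\mathbb{N}$, $n\geq 1$. If Conjecture B holds for $n-1$, then every Lonely Runner Zonotope $Z=\sum_{i=1}^n[\mathbf 0,\mathbf u_i]\subseteq\mathbb{R}^{n-1}$ that violates Conjecture B for $n$, i.e. for which $$\frac{n-1}{n+1}(Z-\mathbf x)\cap(\mathbf x+\mathbb{Z}^{n-1})=\varnothing,\qquad \mathbf x=\tfrac12(\mathbf u_1+\dots+\mathbf u_n),$$ contains at most $\binom{n+1}{2}^{n-1}$ points of $\mathbb{Z}^{n-1}$.
   Context: A Lonely Runner Zonotope (LRZ) of dimension $m-1$ is a zonotope $Z=\sum_{i=1}^m[\mathbf 0,\mathbf u_i]\subseteq\mathbb{R}^{m-1}$ with $m$ generators $\mathbf u_i\in\mathbb{Z}^{m-1}$ in linear general position, i.e. every $m-1$ of the $\mathbf u_i$ are linearly independent. "Conjecture B holds for $m$" (the zonotopal form of the Lonely Runner Conjecture) means: for every Lonely Runner Zonotope $Z=\sum_{i=1}^m[\mathbf 0,\mathbf u_i]$ of dimension $m-1$ one has $$\frac{m-1}{m+1}(Z-\mathbf x)\cap(\mathbf x+\mathbb{Z}^{m-1})\ne\varnothing,$$ where $\mathbf x=\frac12(\mathbf u_1+\dots+\mathbf u_m)$ is the center of $Z$. For $m=0$ the statement is regarded as vacuously true. -}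

module Defs where

open import Algebra.Bundles.Raw using (RawMonoid)
import Algebra.Definitions.RawMonoid as RawMonoidDefinitions
open import Data.Fin.Base using (Fin)
import Data.Integer.Base as ℤ
open ℤ using (ℤ)
open import Data.Nat.Base as ℕ using (ℕ; zero; suc; _∸_)
import Data.Nat.Properties as ℕ
import Data.Rational.Base as ℚ
open ℚ using (ℚ; 0ℚ; 1ℚ; ½)
import Data.Rational.Properties as ℚ
import Data.Rational.Solver as ℚ-Solver
open import Data.Product.Base using (∃; _×_; _,_)
open import Data.Unit.Base using (⊤)
open import Data.Vec.Functional as Vector using (Vector)
open import Function.Base using (_∘_)
open import Function.Definitions using (Injective)
open import Level using (0ℓ)
open import Relation.Binary.PropositionalEquality
  using (_≡_; _≗_; refl; sym; trans; cong; subst)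
open import Relation.Unary using (Pred; _∈_; _∩_; Satisfiable; Empty)

Eventually : (ℕ → Set) → Set
Eventually P = ∃ λ N → ∀ n → N ℕ.≤ n → P n

Cauchy : (ℕ → ℚ) → Set
Cauchy s = ∀ ε → 0ℚ ℚ.< ε →
  ∃ λ N → ∀ m n → N ℕ.≤ m → N ℕ.≤ n → ℚ.∣ s m ℚ.- s n ∣ ℚ.≤ ε

record ℝ : Set where
  constructor mkℝ
  field
    seq    : ℕ → ℚ
    cauchy : Cauchy seq

open ℝ public

infix 4 _≈_ _≤_

_≈_ : ℝ → ℝ → Set
x ≈ y = ∀ ε → 0ℚ ℚ.< ε → Eventually λ n → ℚ.∣ seq x n ℚ.- seq y n ∣ ℚ.≤ ε

_≤_ : ℝ → ℝ → Set
x ≤ y = ∀ ε → 0ℚ ℚ.< ε → Eventually λ n → seq x n ℚ.≤ seq y n ℚ.+ ε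

open ℚ-Solver.+-*-Solver

-- Abstract so that the type checker does not normalise Cauchy moduli occurring
-- in real numbers; only their existence matters.
abstract
  positive-½ : ∀ ε → 0ℚ ℚ.< ε → 0ℚ ℚ.< ½ ℚ.* ε
  positive-½ ε 0<ε = ℚ.positive⁻¹ (½ ℚ.* ε)
    {{ℚ.pos*pos⇒pos ½ ε {{ℚ.positive 0<ε}}}}

  ½+½ : ∀ ε → ½ ℚ.* ε ℚ.+ ½ ℚ.* ε ≡ ε
  ½+½ = solve 1 (λ e → con ½ :* e :+ con ½ :* e := e) refl

  const-cauchy : ∀ q → Cauchy (λ _ → q)
  const-cauchy q ε 0<ε = 0 , λ _ _ _ _ →
    subst (ℚ._≤ ε) (sym (cong ℚ.∣_∣ (ℚ.+-inverseʳ q))) (ℚ.<⇒≤ 0<ε)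

  +-cauchy : ∀ {s t} → Cauchy s → Cauchy t → Cauchy (λ n → s n ℚ.+ t n)
  +-cauchy {s} {t} cs ct ε 0<ε
    with cs (½ ℚ.* ε) (positive-½ ε 0<ε) | ct (½ ℚ.* ε) (positive-½ ε 0<ε)
  ... | M , hM | N , hN = M ℕ.⊔ N , bound
    where
    open ℚ.≤-Reasoning
    rearrange : ∀ a b c d →
      (a ℚ.+ b) ℚ.- (c ℚ.+ d) ≡ (a ℚ.- c) ℚ.+ (b ℚ.- d)
    rearrange = solve 4 (λ a b c d →
      (a :+ b) :- (c :+ d) := (a :- c) :+ (b :- d)) refl
    bound : ∀ m n → M ℕ.⊔ N ℕ.≤ m → M ℕ.⊔ N ℕ.≤ n →
      ℚ.∣ (s m ℚ.+ t m) ℚ.- (s n ℚ.+ t n) ∣ ℚ.≤ ε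
    bound m n p q = begin
      ℚ.∣ (s m ℚ.+ t m) ℚ.- (s n ℚ.+ t n) ∣
        ≡⟨ cong ℚ.∣_∣ (rearrange (s m) (t m) (s n) (t n)) ⟩
      ℚ.∣ (s m ℚ.- s n) ℚ.+ (t m ℚ.- t n) ∣
        ≤⟨ ℚ.∣p+q∣≤∣p∣+∣q∣ (s m ℚ.- s n) (t m ℚ.- t n) ⟩
      ℚ.∣ s m ℚ.- s n ∣ ℚ.+ ℚ.∣ t m ℚ.- t n ∣
        ≤⟨ ℚ.+-mono-≤
             (hM m n (ℕ.m⊔n≤o⇒m≤o M N p) (ℕ.m⊔n≤o⇒m≤o M N q))
             (hN m n (ℕ.m⊔n≤o⇒n≤o M N p) (ℕ.m⊔n≤o⇒n≤o M N q)) ⟩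
      ½ ℚ.* ε ℚ.+ ½ ℚ.* ε
        ≡⟨ ½+½ ε ⟩
      ε ∎

  neg-cauchy : ∀ {s} → Cauchy s → Cauchy (λ n → ℚ.- s n)
  neg-cauchy {s} cs ε 0<ε with cs ε 0<ε
  ... | N , hN = N , λ m n p q →
    subst (ℚ._≤ ε) (sym (flip-sign (s m) (s n))) (hN m n p q)
    where
    factor : ∀ a b → (ℚ.- a) ℚ.- (ℚ.- b) ≡ ℚ.- (a ℚ.- b)
    factor = solve 2 (λ a b → (:- a) :- (:- b) := :- (a :- b)) refl
    flip-sign : ∀ a b → ℚ.∣ (ℚ.- a) ℚ.- (ℚ.- b) ∣ ≡ ℚ.∣ a ℚ.- b ∣
    flip-sign a b = trans (cong ℚ.∣_∣ (factor a b)) (ℚ.∣-p∣≡∣p∣ (a ℚ.- b))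

  eventually-bounded : ∀ {s} → Cauchy s →
    ∃ λ B → ℚ.Positive B × Eventually λ n → ℚ.∣ s n ∣ ℚ.≤ B
  eventually-bounded {s} cs with cs 1ℚ (ℚ.positive⁻¹ 1ℚ)
  ... | N , hN = B , B>0 , N , bound
    where
    open ℚ.≤-Reasoning
    B : ℚ
    B = 1ℚ ℚ.+ ℚ.∣ s N ∣
    B>0 : ℚ.Positive B
    B>0 = ℚ.pos+nonNeg⇒pos 1ℚ ℚ.∣ s N ∣ {{ℚ.∣-∣-nonNeg (s N)}}
    split : ∀ a b → a ≡ (a ℚ.- b) ℚ.+ b
    split = solve 2 (λ a b → a := (a :- b) :+ b) refl
    bound : ∀ n → N ℕ.≤ n → ℚ.∣ s n ∣ ℚ.≤ B
    bound n p = begin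
      ℚ.∣ s n ∣                              ≡⟨ cong ℚ.∣_∣ (split (s n) (s N)) ⟩
      ℚ.∣ (s n ℚ.- s N) ℚ.+ s N ∣            ≤⟨ ℚ.∣p+q∣≤∣p∣+∣q∣ (s n ℚ.- s N) (s N) ⟩
      ℚ.∣ s n ℚ.- s N ∣ ℚ.+ ℚ.∣ s N ∣        ≤⟨ ℚ.+-monoˡ-≤ ℚ.∣ s N ∣ (hN n N p ℕ.≤-refl) ⟩
      1ℚ ℚ.+ ℚ.∣ s N ∣                       ∎

  quotient : ∀ ε C → 0ℚ ℚ.< ε → ℚ.Positive C →
    ∃ λ δ → 0ℚ ℚ.< δ × δ ℚ.* C ≡ ε
  quotient ε C 0<ε C>0 = ε ℚ.* C⁻¹ , ℚ.positive⁻¹ (ε ℚ.* C⁻¹) {{δ>0}} , δC≡ε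
    where
    C≢0 : ℚ.NonZero C
    C≢0 = ℚ.pos⇒nonZero C {{C>0}}
    C⁻¹ : ℚ
    C⁻¹ = (ℚ.1/ C) {{C≢0}}
    δ>0 : ℚ.Positive (ε ℚ.* C⁻¹)
    δ>0 = ℚ.pos*pos⇒pos ε {{ℚ.positive 0<ε}} C⁻¹ {{ℚ.1/pos⇒pos C {{C>0}}}}
    δC≡ε : ε ℚ.* C⁻¹ ℚ.* C ≡ ε
    δC≡ε = trans (ℚ.*-assoc ε C⁻¹ C)
      (trans (cong (ε ℚ.*_) (ℚ.*-inverseˡ C {{C≢0}})) (ℚ.*-identityʳ ε))

  product-bound : ∀ a b c d {A B δ} → ℚ.Positive A → ℚ.Positive B →
    ℚ.∣ a ∣ ℚ.≤ A → ℚ.∣ d ∣ ℚ.≤ B →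
    ℚ.∣ a ℚ.- c ∣ ℚ.≤ δ → ℚ.∣ b ℚ.- d ∣ ℚ.≤ δ →
    ℚ.∣ a ℚ.* b ℚ.- c ℚ.* d ∣ ℚ.≤ δ ℚ.* (A ℚ.+ B)
  product-bound a b c d {A} {B} {δ} A>0 B>0 a≤A d≤B a-c≤δ b-d≤δ = begin
    ℚ.∣ a ℚ.* b ℚ.- c ℚ.* d ∣
      ≡⟨ cong ℚ.∣_∣ (rearrange a b c d) ⟩
    ℚ.∣ a ℚ.* (b ℚ.- d) ℚ.+ d ℚ.* (a ℚ.- c) ∣
      ≤⟨ ℚ.∣p+q∣≤∣p∣+∣q∣ (a ℚ.* (b ℚ.- d)) (d ℚ.* (a ℚ.- c)) ⟩
    ℚ.∣ a ℚ.* (b ℚ.- d) ∣ ℚ.+ ℚ.∣ d ℚ.* (a ℚ.- c) ∣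
      ≤⟨ ℚ.+-mono-≤ (∣*∣-bound a (b ℚ.- d) A>0 a≤A b-d≤δ)
                    (∣*∣-bound d (a ℚ.- c) B>0 d≤B a-c≤δ) ⟩
    A ℚ.* δ ℚ.+ B ℚ.* δ
      ≡⟨ collect A B δ ⟩
    δ ℚ.* (A ℚ.+ B) ∎
    where
    open ℚ.≤-Reasoning
    rearrange : ∀ a b c d →
      a ℚ.* b ℚ.- c ℚ.* d ≡ a ℚ.* (b ℚ.- d) ℚ.+ d ℚ.* (a ℚ.- c)
    rearrange = solve 4 (λ a b c d →
      a :* b :- c :* d := a :* (b :- d) :+ d :* (a :- c)) refl
    collect : ∀ a b e → a ℚ.* e ℚ.+ b ℚ.* e ≡ e ℚ.* (a ℚ.+ b)
    collect = solve 3 (λ a b e → a :* e :+ b :* e := e :* (a :+ b)) refl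
    ∣*∣-bound : ∀ x y {X Y} → ℚ.Positive X →
      ℚ.∣ x ∣ ℚ.≤ X → ℚ.∣ y ∣ ℚ.≤ Y → ℚ.∣ x ℚ.* y ∣ ℚ.≤ X ℚ.* Y
    ∣*∣-bound x y {X} {Y} X>0 x≤X y≤Y = begin
      ℚ.∣ x ℚ.* y ∣        ≡⟨ ℚ.∣p*q∣≡∣p∣*∣q∣ x y ⟩
      ℚ.∣ x ∣ ℚ.* ℚ.∣ y ∣  ≤⟨ ℚ.*-monoʳ-≤-nonNeg ℚ.∣ y ∣ {{ℚ.∣-∣-nonNeg y}} x≤X ⟩
      X ℚ.* ℚ.∣ y ∣        ≤⟨ ℚ.*-monoˡ-≤-nonNeg X {{ℚ.pos⇒nonNeg X {{X>0}}}} y≤Y ⟩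
      X ℚ.* Y              ∎

  *-cauchy : ∀ {s t} → Cauchy s → Cauchy t → Cauchy (λ n → s n ℚ.* t n)
  *-cauchy {s} {t} cs ct ε 0<ε =
    let A , A>0 , K , hK = eventually-bounded cs
        B , B>0 , L , hL = eventually-bounded ct
        δ , 0<δ , δC≡ε   = quotient ε (A ℚ.+ B) 0<ε
                             (ℚ.pos+pos⇒pos A {{A>0}} B {{B>0}})
        M , hM           = cs δ 0<δ
        N , hN           = ct δ 0<δ
    in (K ℕ.⊔ L) ℕ.⊔ (M ℕ.⊔ N) , λ m n p q →
      let KL≤m = ℕ.m⊔n≤o⇒m≤o (K ℕ.⊔ L) (M ℕ.⊔ N) p
          MN≤m = ℕ.m⊔n≤o⇒n≤o (K ℕ.⊔ L) (M ℕ.⊔ N) p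
          KL≤n = ℕ.m⊔n≤o⇒m≤o (K ℕ.⊔ L) (M ℕ.⊔ N) q
          MN≤n = ℕ.m⊔n≤o⇒n≤o (K ℕ.⊔ L) (M ℕ.⊔ N) q
      in subst (ℚ.∣ s m ℚ.* t m ℚ.- s n ℚ.* t n ∣ ℚ.≤_) δC≡ε
           (product-bound (s m) (t m) (s n) (t n) A>0 B>0
             (hK m (ℕ.m⊔n≤o⇒m≤o K L KL≤m))
             (hL n (ℕ.m⊔n≤o⇒n≤o K L KL≤n))
             (hM m n (ℕ.m⊔n≤o⇒m≤o M N MN≤m) (ℕ.m⊔n≤o⇒m≤o M N MN≤n))
             (hN m n (ℕ.m⊔n≤o⇒n≤o M N MN≤m) (ℕ.m⊔n≤o⇒n≤o M N MN≤n)))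

fromℚ : ℚ → ℝ
fromℚ q = mkℝ (λ _ → q) (const-cauchy q)

fromℤ : ℤ → ℝ
fromℤ z = fromℚ (z ℚ./ 1)

0ℝ 1ℝ : ℝ
0ℝ = fromℚ 0ℚ
1ℝ = fromℚ 1ℚ

infix  8 -_
infixl 7 _*_
infixl 6 _+_ _-_

_+_ : ℝ → ℝ → ℝ
x + y = mkℝ (λ n → seq x n ℚ.+ seq y n) (+-cauchy {seq x} {seq y} (cauchy x) (cauchy y))

-_ : ℝ → ℝ
- x = mkℝ (λ n → ℚ.- seq x n) (neg-cauchy {seq x} (cauchy x))

_-_ : ℝ → ℝ → ℝ
x - y = x + (- y)

_*_ : ℝ → ℝ → ℝ
x * y = mkℝ (λ n → seq x n ℚ.* seq y n) (*-cauchy {seq x} {seq y} (cauchy x) (cauchy y))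

+-0-rawMonoid : RawMonoid 0ℓ 0ℓ
+-0-rawMonoid = record { _≈_ = _≈_ ; _∙_ = _+_ ; ε = 0ℝ }

open RawMonoidDefinitions +-0-rawMonoid public using (sum)

infix  4 _≋_
infixl 7 _•_
infixl 6 _⊕_ _⊖_

_≋_ : ∀ {d} → Vector ℝ d → Vector ℝ d → Set
v ≋ w = ∀ j → v j ≈ w j

𝟎 : ∀ {d} → Vector ℝ d
𝟎 = Vector.replicate _ 0ℝ

_⊕_ _⊖_ : ∀ {d} → Vector ℝ d → Vector ℝ d → Vector ℝ d
_⊕_ = Vector.zipWith _+_
_⊖_ = Vector.zipWith _-_

_•_ : ∀ {d} → ℝ → Vector ℝ d → Vector ℝ d
c • v = Vector.map (c *_) v

∑ : ∀ {d m} → Vector (Vector ℝ d) m → Vector ℝ d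
∑ v j = sum (λ i → v i j)

ι : ∀ {d} → Vector ℤ d → Vector ℝ d
ι = Vector.map fromℤ

LinearlyIndependent : ∀ {d k} → Vector (Vector ℝ d) k → Set
LinearlyIndependent {k = k} v =
  (c : Vector ℝ k) → ∑ (λ i → c i • v i) ≋ 𝟎 → ∀ i → c i ≈ 0ℝ

-- Subfamilies of size d are given by injections Fin d → Fin m.
LinearGeneralPosition : ∀ {d m} → Vector (Vector ℝ d) m → Set
LinearGeneralPosition {d} {m} v =
  (σ : Fin d → Fin m) → Injective _≡_ _≡_ σ → LinearlyIndependent (v ∘ σ)

Region : ℕ → Set₁
Region d = Pred (Vector ℝ d) 0ℓ

Segment : ∀ {d} → Vector ℝ d → Vector ℝ d → Region d
Segment a b p = ∃ λ t → 0ℝ ≤ t × t ≤ 1ℝ × p ≋ (1ℝ - t) • a ⊕ t • b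

MinkowskiSum : ∀ {d m} → (Fin m → Region d) → Region d
MinkowskiSum {d} {m} S p =
  ∃ λ (q : Vector (Vector ℝ d) m) → (∀ i → q i ∈ S i) × p ≋ ∑ q

ScaledTranslate : ∀ {d} → ℝ → Region d → Vector ℝ d → Region d
ScaledTranslate c S x p = ∃ λ z → z ∈ S × p ≋ c • (z ⊖ x)

LatticeCoset : ∀ {d} → Vector ℝ d → Region d
LatticeCoset {d} x p = ∃ λ (k : Vector ℤ d) → p ≋ x ⊕ ι k

-- Without function extensionality, lattice points have to be distinguished
-- by the pointwise equality _≗_ rather than by _≡_.
ContainsAtMost_LatticePoints : ∀ {d} → ℕ → Region d → Set
ContainsAtMost_LatticePoints {d} N S =
  ∀ k (p : Fin k → Vector ℤ d) → Injective _≡_ _≗_ p →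
  (∀ i → ι (p i) ∈ S) → k ℕ.≤ N

record LonelyRunnerZonotope (m : ℕ) : Set where
  field
    generators      : Vector (Vector ℤ (m ∸ 1)) m
    generalPosition : LinearGeneralPosition (ι ∘ generators)

  points : Region (m ∸ 1)
  points = MinkowskiSum (λ i → Segment 𝟎 (ι (generators i)))

  center : Vector ℝ (m ∸ 1)
  center = fromℚ ½ • ∑ (ι ∘ generators)

  shrunkCosetPoints : Region (m ∸ 1)
  shrunkCosetPoints =
    ScaledTranslate (fromℚ (ℤ.+ (m ∸ 1) ℚ./ suc m)) points center
      ∩ LatticeCoset center

open LonelyRunnerZonotope public

-- The case 0 is separate because 0 ∸ 1 is 0, whereas there are no zonotopes
-- of dimension −1.
ConjectureB : ℕ → Set
ConjectureB zero      = ⊤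
ConjectureB m@(suc _) =
  (Z : LonelyRunnerZonotope m) → Satisfiable (shrunkCosetPoints Z)

ViolatesConjectureB : ∀ {m} → LonelyRunnerZonotope m → Set
ViolatesConjectureB Z = Empty (shrunkCosetPoints Z)

-- Write N = (n+1 choose 2), let U be the linear map with columns uᵢ and let Z contain more than
-- N^(n-1) lattice points. Two of them are congruent mod N, so their difference is N w with w an
-- integer vector, and w = U a with real |aᵢ| ≤ 1/N. The plane { x : U x ∈ ℝ w } contains an integer
-- vector v without zero entries, two of whose entries agree up to sign: take a crossing of two of
-- the functions |aᵢ + λ vᵢ| between neighbouring zeros. Dropping one of the two entries leaves n-1
-- nonzero velocities. They are the linear dependence of the generators of a Lonely Runner Zonotope
-- of dimension n-2, and Conjecture B for n-1 yields a time τ at which every τ vᵢ has distance at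
-- least 1/n to ℤ, including the dropped one. Reducing mod ℤ gives c ∈ [1/n, 1-1/n]ⁿ with
-- U c ∈ ℤ^(n-1) + ℝ w. Adding s a with |s| ≤ 1/2 makes U c integral, and since
-- 1/(2N) = 1/n - 1/(n+1) the result lies in [1/(n+1), n/(n+1)]ⁿ: Z does not violate Conjecture B.
module Submission where

open import Defs using (LonelyRunnerZonotope; points; ConjectureB; ViolatesConjectureB; ContainsAtMost_LatticePoints)
open import Data.Nat.Base using (ℕ; suc; _∸_; _^_; _≥_)
open import Data.Nat.Combinatorics using (_C_; nC1≡n; nCk+nC[k+1]≡[n+1]C[k+1])

open import Defs
  using (Eventually; ℝ; seq; _≈_; _≤_; quotient; fromℚ; fromℤ; 0ℝ; 1ℝ; _+_; _-_; _*_;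
         ι; 𝟎; ∑; _•_; _⊕_; _⊖_; Segment; MinkowskiSum; LinearlyIndependent;
         LinearGeneralPosition; center; shrunkCosetPoints)
import Defs
open import Algebra.Bundles using (CommutativeRing)
import Algebra.Properties.Semiring.Sum as SemiringSum
open import Data.Fin.Base using (Fin; zero; suc; punchIn; punchOut; fromℕ<; funToFin; finToFun)
import Data.Fin.Properties as Fin
import Data.Integer.Base as ℤ
open ℤ using (ℤ; 0ℤ; 1ℤ; -1ℤ; +_; -[1+_])
import Data.Integer.DivMod as ℤ
import Data.Integer.Properties as ℤ
open import Data.Integer.Tactic.RingSolver using () renaming (solve-∀ to ℤ-solve-∀)
open import Data.Nat.Base as ℕ using (zero)
import Data.Nat.Divisibility as ℕ
import Data.Nat.GCD as ℕ
import Data.Nat.Properties as ℕ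
open import Data.Product.Base using (∃; ∃₂; _×_; _,_; proj₁; proj₂)
import Data.Rational.Base as ℚ
open ℚ using (ℚ; 0ℚ; 1ℚ; ½)
import Data.Rational.Properties as ℚ
import Data.Rational.Unnormalised.Base as ℚᵘ
open ℚᵘ using (mkℚᵘ; *≡*; *≤*)
import Data.Rational.Unnormalised.Properties as ℚᵘ
open import Data.Sum.Base using (_⊎_; inj₁; inj₂)
open import Data.Unit.Base using (tt)
open import Data.Vec.Functional using (Vector; removeAt)
open import Function.Base using (_∘_; _$_)
open import Function.Definitions using (Injective)
open import Level using (0ℓ)
open import Relation.Binary.PropositionalEquality
open import Relation.Nullary using (¬_; yes; no; contradiction)
open import Relation.Nullary.Decidable using (¬?; dec⇒maybe; decidable-stable)
open import Relation.Unary using (_∈_; Decidable; Satisfiable)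
open import Relation.Unary.Properties using (U?)
open import Tactic.RingSolver using (solve-∀)
open import Tactic.RingSolver.Core.AlmostCommutativeRing using (AlmostCommutativeRing; fromCommutativeRing)


-- Integer linear algebra

-- The order of Cauchy reals cannot be decided, so whatever has to be chosen by comparison (the
-- velocities, the time τ, the rounding of τ κ) is chosen in ℤ or ℚ. Only the coefficients of the
-- given points of Z and those obtained from Conjecture B stay real. Two preimages of w serve
-- different purposes. The plane over ℝ w depends only on the direction of w, so its integer vectors
-- are built from an integer `a` with U a = κ w and an integer relation `v` of the generators. The
-- real preimage (t - t′)/N, whose entries are small, enters only in the final correction. Two
-- velocities equal up to sign are wanted because the distance to ℤ ignores signs: n velocities are
-- then served by Conjecture B for n-1, which grants distance 1/n. The surplus over 1/(n+1) pays for
-- the correction. The zonotope for given velocities has as generators the images of the unit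
-- vectors in the integer lattice modulo the primitive vector along the velocities. This quotient is
-- free, and the absence of zero velocities amounts to general position.

module ℤΣ = SemiringSum ℤ.+-*-semiring

Σℤ : ∀ {n} → Vector ℤ n → ℤ
Σℤ = ℤΣ.sum

Σℤ-zero : ∀ {n} {f : Vector ℤ n} → (∀ i → f i ≡ 0ℤ) → Σℤ f ≡ 0ℤ
Σℤ-zero {n} f≡0 = trans (ℤΣ.sum-cong-≗ f≡0) (ℤΣ.sum-replicate-zero n)

unit-sign : ∀ z → ∃ λ s → s ℤ.* s ≡ 1ℤ × s ℤ.* z ≡ + ℤ.∣ z ∣
unit-sign (+ n)      = 1ℤ , refl , ℤ.*-identityˡ (+ n)
unit-sign (-[1+ n ]) = ℤ.-1ℤ , refl , ℤ.-1*i≡-i -[1+ n ]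

from-abs : ∀ s z {n} → s ℤ.* s ≡ 1ℤ → s ℤ.* z ≡ n → z ≡ s ℤ.* n
from-abs s z s²≡1 refl = begin
  z                ≡⟨ ℤ.*-identityˡ z ⟨
  1ℤ ℤ.* z         ≡⟨ cong (ℤ._* z) s²≡1 ⟨
  s ℤ.* s ℤ.* z    ≡⟨ ℤ.*-assoc s s z ⟩
  s ℤ.* (s ℤ.* z)  ∎
  where open ≡-Reasoning

-- The identity is required of the cofactors `α`, `β` instead of `a`, `b`. It thus makes sense also
-- for a = b = 0, where g = 0, and it completes (α, β) to a matrix of determinant 1.
Bézout : ℤ → ℤ → Set
Bézout a b = ∃ λ g → ∃₂ λ α β → ∃₂ λ x y →
  a ≡ g ℤ.* α × b ≡ g ℤ.* β × x ℤ.* α ℤ.+ y ℤ.* β ≡ 1ℤ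

-- Every term of the identity over ℕ is a multiple of `d`, which cancels because it is nonzero.
bézout-from-identity : ∀ d α β x y → ¬ d ≡ 0 → d ℕ.+ y ℕ.* (β ℕ.* d) ≡ x ℕ.* (α ℕ.* d) →
  + x ℤ.* + α ℤ.+ ℤ.- + y ℤ.* + β ≡ 1ℤ
bézout-from-identity zero        α β x y d≢0 eq = contradiction refl d≢0
bézout-from-identity d@(suc _) α β x y _ eq = begin
  + x ℤ.* + α ℤ.+ ℤ.- + y ℤ.* + β        ≡⟨ cong (ℤ._+ ℤ.- + y ℤ.* + β) cancelled ⟨
  (1ℤ ℤ.+ + y ℤ.* + β) ℤ.+ ℤ.- + y ℤ.* + β  ≡⟨ collapse (+ y) (+ β) ⟩
  1ℤ                                      ∎
  where
  open ≡-Reasoning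
  collapse : ∀ y β → (1ℤ ℤ.+ y ℤ.* β) ℤ.+ ℤ.- y ℤ.* β ≡ 1ℤ
  collapse = ℤ-solve-∀
  factor : ∀ d y β → (1ℤ ℤ.+ y ℤ.* β) ℤ.* d ≡ d ℤ.+ y ℤ.* (β ℤ.* d)
  factor = ℤ-solve-∀
  push : ∀ m n → + (m ℕ.* (n ℕ.* d)) ≡ + m ℤ.* (+ n ℤ.* + d)
  push m n = trans (ℤ.pos-* m (n ℕ.* d)) (cong ((+ m) ℤ.*_) (ℤ.pos-* n d))
  cancelled : 1ℤ ℤ.+ + y ℤ.* + β ≡ + x ℤ.* + α
  cancelled = ℤ.*-cancelʳ-≡ _ _ (+ d) $ begin
    (1ℤ ℤ.+ + y ℤ.* + β) ℤ.* + d       ≡⟨ factor (+ d) (+ y) (+ β) ⟩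
    + d ℤ.+ + y ℤ.* (+ β ℤ.* + d)      ≡⟨ cong (λ z → + d ℤ.+ z) (push y β) ⟨
    + d ℤ.+ + (y ℕ.* (β ℕ.* d))        ≡⟨ ℤ.pos-+ d _ ⟨
    + (d ℕ.+ y ℕ.* (β ℕ.* d))          ≡⟨ cong +_ eq ⟩
    + (x ℕ.* (α ℕ.* d))                ≡⟨ push x α ⟩
    + x ℤ.* (+ α ℤ.* + d)              ≡⟨ ℤ.*-assoc (+ x) (+ α) (+ d) ⟨
    + x ℤ.* + α ℤ.* + d                ∎

pos-*-comm : ∀ k d → + (k ℕ.* d) ≡ + d ℤ.* + k
pos-*-comm k d = trans (ℤ.pos-* k d) (ℤ.*-comm (+ k) (+ d))

bézout-ℕ : ∀ m n → Bézout (+ m) (+ n)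
bézout-ℕ m n with ℕ.Bézout.lemma m n
... | ℕ.Bézout.result d g identity with ℕ.GCD.gcd∣m g | ℕ.GCD.gcd∣n g
...   | ℕ.divides α refl | ℕ.divides β refl with d ℕ.≟ 0
...     | yes refl = 0ℤ , 1ℤ , 0ℤ , 1ℤ , 0ℤ ,
                     cong +_ (ℕ.*-zeroʳ α) , cong +_ (ℕ.*-zeroʳ β) , refl
...     | no d≢0 with identity
...       | ℕ.Bézout.+- x y eq =
              + d , + α , + β , + x , ℤ.- + y , pos-*-comm α d , pos-*-comm β d ,
              bézout-from-identity d α β x y d≢0 eq
...       | ℕ.Bézout.-+ x y eq =
              + d , + α , + β , ℤ.- + x , + y , pos-*-comm α d , pos-*-comm β d ,
              trans (ℤ.+-comm (ℤ.- + x ℤ.* + α) (+ y ℤ.* + β))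
                (bézout-from-identity d β α y x d≢0 eq)

bézout : ∀ a b → Bézout a b
bézout a b with unit-sign a | unit-sign b | bézout-ℕ ℤ.∣ a ∣ ℤ.∣ b ∣
... | s , s²≡1 , sa≡∣a∣ | t , t²≡1 , tb≡∣b∣ | g , α , β , x , y , ∣a∣≡gα , ∣b∣≡gβ , identity =
  g , s ℤ.* α , t ℤ.* β , x ℤ.* s , y ℤ.* t ,
  trans (from-abs s a s²≡1 (trans sa≡∣a∣ ∣a∣≡gα)) (swap s g α) ,
  trans (from-abs t b t²≡1 (trans tb≡∣b∣ ∣b∣≡gβ)) (swap t g β) ,
  (begin
    x ℤ.* s ℤ.* (s ℤ.* α) ℤ.+ y ℤ.* t ℤ.* (t ℤ.* β)
      ≡⟨ collect x s α y t β ⟩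
    s ℤ.* s ℤ.* (x ℤ.* α) ℤ.+ t ℤ.* t ℤ.* (y ℤ.* β)
      ≡⟨ cong₂ (λ u v → u ℤ.* (x ℤ.* α) ℤ.+ v ℤ.* (y ℤ.* β)) s²≡1 t²≡1 ⟩
    1ℤ ℤ.* (x ℤ.* α) ℤ.+ 1ℤ ℤ.* (y ℤ.* β)
      ≡⟨ cong₂ ℤ._+_ (ℤ.*-identityˡ (x ℤ.* α)) (ℤ.*-identityˡ (y ℤ.* β)) ⟩
    x ℤ.* α ℤ.+ y ℤ.* β
      ≡⟨ identity ⟩
    1ℤ ∎)
  where
  open ≡-Reasoning
  swap : ∀ s g α → s ℤ.* (g ℤ.* α) ≡ g ℤ.* (s ℤ.* α)
  swap = ℤ-solve-∀
  collect : ∀ x s α y t β →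
    x ℤ.* s ℤ.* (s ℤ.* α) ℤ.+ y ℤ.* t ℤ.* (t ℤ.* β) ≡
    s ℤ.* s ℤ.* (x ℤ.* α) ℤ.+ t ℤ.* t ℤ.* (y ℤ.* β)
  collect = ℤ-solve-∀

δ : ∀ {n} → Fin n → Fin n → ℤ
δ zero    zero    = 1ℤ
δ zero    (suc j) = 0ℤ
δ (suc i) zero    = 0ℤ
δ (suc i) (suc j) = δ i j

-- resolution says T⁻¹T = I, where T has rows height and (λ j → generator j l), and T⁻¹ has
-- columns direction and lift l. Thus direction spans the kernel of the matrix with
-- columns generator j, and lift is an integral section of that matrix.
record UnimodularCompletion {m} (v : Vector ℤ (suc m)) : Set where
  field
    content    : ℤ
    direction  : Vector ℤ (suc m)
    height     : Vector ℤ (suc m)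
    lift       : Vector (Vector ℤ (suc m)) m
    generator  : Vector (Vector ℤ m) (suc m)
    v≡         : ∀ i → v i ≡ content ℤ.* direction i
    resolution : ∀ i j → direction i ℤ.* height j ℤ.+
                   Σℤ (λ l → lift l i ℤ.* generator j l) ≡ δ i j

-- The old T⁻¹ is bordered by 1, and its first two columns (the new unit vector and the old
-- direction) are multiplied by the 2×2 matrix with columns (α, β) and (-y, x). Its determinant is 1
-- by the Bézout identity. The first two rows of T are multiplied by the inverse, with rows (x, y)
-- and (-β, α). The content `g` of the longer vector is the gcd of `v zero` and the old content.
extend-completion : ∀ {m} (v : Vector ℤ (suc (suc m))) (U : UnimodularCompletion (v ∘ suc)) →
  Bézout (v zero) (UnimodularCompletion.content U) → UnimodularCompletion v
extend-completion {m} v U (g , α , β , x , y , v₀≡gα , g⁺≡gβ , identity) = record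
  { content    = g
  ; direction  = b′
  ; height     = h′
  ; lift       = L′
  ; generator  = G′
  ; v≡         = v≡′
  ; resolution = resolution′
  }
  where
  open ≡-Reasoning
  open UnimodularCompletion U renaming
    (direction to b; height to h; lift to L; generator to G)
  b′ : Vector ℤ (suc (suc m))
  b′ zero    = α
  b′ (suc i) = b i ℤ.* β
  h′ : Vector ℤ (suc (suc m))
  h′ zero    = x
  h′ (suc j) = y ℤ.* h j
  L′ : Vector (Vector ℤ (suc (suc m))) (suc m)
  L′ zero    zero    = ℤ.- y
  L′ zero    (suc i) = b i ℤ.* x
  L′ (suc l) zero    = 0ℤ
  L′ (suc l) (suc i) = L l i
  G′ : Vector (Vector ℤ (suc m)) (suc (suc m))
  G′ zero    zero    = ℤ.- β
  G′ zero    (suc l) = 0ℤ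
  G′ (suc j) zero    = α ℤ.* h j
  G′ (suc j) (suc l) = G j l

  swap : ∀ g β b → g ℤ.* β ℤ.* b ≡ g ℤ.* (b ℤ.* β)
  swap = ℤ-solve-∀
  v≡′ : ∀ i → v i ≡ g ℤ.* b′ i
  v≡′ zero    = v₀≡gα
  v≡′ (suc i) = trans (v≡ i) (trans (cong (ℤ._* b i) g⁺≡gβ) (swap g β (b i)))

  eq₀₀ : ∀ α β x y →
    α ℤ.* x ℤ.+ (ℤ.- y ℤ.* ℤ.- β ℤ.+ 0ℤ) ≡ x ℤ.* α ℤ.+ y ℤ.* β
  eq₀₀ = ℤ-solve-∀
  eq₀₁ : ∀ α y h → α ℤ.* (y ℤ.* h) ℤ.+ (ℤ.- y ℤ.* (α ℤ.* h) ℤ.+ 0ℤ) ≡ 0ℤ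
  eq₀₁ = ℤ-solve-∀
  eq₁₀ : ∀ b β x → b ℤ.* β ℤ.* x ℤ.+ (b ℤ.* x ℤ.* ℤ.- β ℤ.+ 0ℤ) ≡ 0ℤ
  eq₁₀ = ℤ-solve-∀
  eq₁₁ : ∀ b h α β x y s →
    b ℤ.* β ℤ.* (y ℤ.* h) ℤ.+ (b ℤ.* x ℤ.* (α ℤ.* h) ℤ.+ s) ≡
    (x ℤ.* α ℤ.+ y ℤ.* β) ℤ.* (b ℤ.* h) ℤ.+ s
  eq₁₁ = ℤ-solve-∀

  resolution′ : ∀ i j → b′ i ℤ.* h′ j ℤ.+ Σℤ (λ l → L′ l i ℤ.* G′ j l) ≡ δ i j
  resolution′ zero zero = begin
    α ℤ.* x ℤ.+ (ℤ.- y ℤ.* ℤ.- β ℤ.+ Σℤ {m} (λ l → 0ℤ ℤ.* 0ℤ))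
      ≡⟨ cong (λ s → α ℤ.* x ℤ.+ (ℤ.- y ℤ.* ℤ.- β ℤ.+ s)) (Σℤ-zero {m} (λ _ → refl)) ⟩
    α ℤ.* x ℤ.+ (ℤ.- y ℤ.* ℤ.- β ℤ.+ 0ℤ)
      ≡⟨ eq₀₀ α β x y ⟩
    x ℤ.* α ℤ.+ y ℤ.* β
      ≡⟨ identity ⟩
    1ℤ ∎
  resolution′ zero (suc j) = begin
    α ℤ.* (y ℤ.* h j) ℤ.+ (ℤ.- y ℤ.* (α ℤ.* h j) ℤ.+ Σℤ (λ l → 0ℤ ℤ.* G j l))
      ≡⟨ cong (λ s → α ℤ.* (y ℤ.* h j) ℤ.+ (ℤ.- y ℤ.* (α ℤ.* h j) ℤ.+ s))
           (Σℤ-zero (λ l → ℤ.*-zeroˡ (G j l))) ⟩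
    α ℤ.* (y ℤ.* h j) ℤ.+ (ℤ.- y ℤ.* (α ℤ.* h j) ℤ.+ 0ℤ)
      ≡⟨ eq₀₁ α y (h j) ⟩
    0ℤ ∎
  resolution′ (suc i) zero = begin
    b i ℤ.* β ℤ.* x ℤ.+ (b i ℤ.* x ℤ.* ℤ.- β ℤ.+ Σℤ (λ l → L l i ℤ.* 0ℤ))
      ≡⟨ cong (λ s → b i ℤ.* β ℤ.* x ℤ.+ (b i ℤ.* x ℤ.* ℤ.- β ℤ.+ s))
           (Σℤ-zero (λ l → ℤ.*-zeroʳ (L l i))) ⟩
    b i ℤ.* β ℤ.* x ℤ.+ (b i ℤ.* x ℤ.* ℤ.- β ℤ.+ 0ℤ)
      ≡⟨ eq₁₀ (b i) β x ⟩
    0ℤ ∎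
  resolution′ (suc i) (suc j) = begin
    b i ℤ.* β ℤ.* (y ℤ.* h j) ℤ.+ (b i ℤ.* x ℤ.* (α ℤ.* h j) ℤ.+ S)
      ≡⟨ eq₁₁ (b i) (h j) α β x y S ⟩
    (x ℤ.* α ℤ.+ y ℤ.* β) ℤ.* (b i ℤ.* h j) ℤ.+ S
      ≡⟨ cong (λ w → w ℤ.* (b i ℤ.* h j) ℤ.+ S) identity ⟩
    1ℤ ℤ.* (b i ℤ.* h j) ℤ.+ S
      ≡⟨ cong (ℤ._+ S) (ℤ.*-identityˡ (b i ℤ.* h j)) ⟩
    b i ℤ.* h j ℤ.+ S
      ≡⟨ resolution i j ⟩
    δ i j ∎
    where S = Σℤ (λ l → L l i ℤ.* G j l)

unimodularCompletion : ∀ {m} (v : Vector ℤ (suc m)) → UnimodularCompletion v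
unimodularCompletion {zero} v = record
  { content    = v zero
  ; direction  = λ _ → 1ℤ
  ; height     = λ _ → 1ℤ
  ; lift       = λ ()
  ; generator  = λ _ ()
  ; v≡         = λ { zero → sym (ℤ.*-identityʳ (v zero)) }
  ; resolution = λ { zero zero → refl }
  }
unimodularCompletion {suc m} v = extend-completion v U (bézout (v zero) (content U))
  where
  open UnimodularCompletion using (content)
  U = unimodularCompletion (v ∘ suc)

IntegerRelation : ∀ {n d} → Vector (Vector ℤ d) n → Vector ℤ n → Set
IntegerRelation u c = ∀ l → Σℤ (λ k → c k ℤ.* u k l) ≡ 0ℤ

-- Gaussian elimination on the first coordinate, with pivot p.
nontrivial-relation : ∀ {d} (u : Vector (Vector ℤ d) (suc d)) →
  ∃ λ c → (∃ λ k → c k ≢ 0ℤ) × IntegerRelation u c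
nontrivial-relation {zero} u = (λ _ → 1ℤ) , (zero , λ ()) , λ ()
nontrivial-relation {suc d} u with Fin.any? (λ k → ¬? (u k zero ℤ.≟ 0ℤ))
... | no u₀≡0 with nontrivial-relation (λ k l → u (suc k) (suc l))
...   | c , (k₀ , c≢0) , rel = c′ , (suc k₀ , c≢0) , rel′
  where
  c′ : Vector ℤ (suc (suc d))
  c′ zero    = 0ℤ
  c′ (suc k) = c k
  u₀≡0′ : ∀ k → u k zero ≡ 0ℤ
  u₀≡0′ k = decidable-stable (u k zero ℤ.≟ 0ℤ) (λ ≢0 → u₀≡0 (k , ≢0))
  rel′ : IntegerRelation u c′
  rel′ zero    = Σℤ-zero λ k → trans (cong (c′ k ℤ.*_) (u₀≡0′ k)) (ℤ.*-zeroʳ (c′ k))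
  rel′ (suc l) = begin
    0ℤ ℤ.* u zero (suc l) ℤ.+ S  ≡⟨ cong (ℤ._+ S) (ℤ.*-zeroˡ (u zero (suc l))) ⟩
    0ℤ ℤ.+ S                     ≡⟨ ℤ.+-identityˡ S ⟩
    S                            ≡⟨ rel l ⟩
    0ℤ                           ∎
    where
    open ≡-Reasoning
    S = Σℤ (λ k → c k ℤ.* u (suc k) (suc l))
nontrivial-relation {suc d} u | yes (p , a≢0)
  with nontrivial-relation (λ k l →
         u p zero ℤ.* u (punchIn p k) (suc l) ℤ.- u (punchIn p k) zero ℤ.* u p (suc l))
... | c , (k₀ , c≢0) , rel = c′ , (punchIn p k₀ , c′≢0) , rel′
  where
  open ≡-Reasoning
  a = u p zero
  w = removeAt u p
  S = Σℤ (λ k → c k ℤ.* w k zero)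
  -- Scaling the other coefficients by `a` makes their first coordinates add up to a S, which the
  -- coefficient -S of the pivot, with first coordinate `a`, cancels.
  c′ : Vector ℤ (suc (suc d))
  c′ k with p Fin.≟ k
  ... | yes _   = ℤ.- S
  ... | no  p≢k = a ℤ.* c (punchOut p≢k)
  c′-p : c′ p ≡ ℤ.- S
  c′-p with p Fin.≟ p
  ... | yes _   = refl
  ... | no  p≢p = contradiction refl p≢p
  c′-punchIn : ∀ k → c′ (punchIn p k) ≡ a ℤ.* c k
  c′-punchIn k with p Fin.≟ punchIn p k
  ... | yes p≡  = contradiction (sym p≡) (Fin.punchInᵢ≢i p k)
  ... | no  p≢  = cong (λ i → a ℤ.* c i)
                    (trans (Fin.punchOut-cong p refl) (Fin.punchOut-punchIn p))
  c′≢0 : c′ (punchIn p k₀) ≢ 0ℤ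
  c′≢0 eq with ℤ.i*j≡0⇒i≡0∨j≡0 a (trans (sym (c′-punchIn k₀)) eq)
  ... | inj₁ a≡0 = a≢0 a≡0
  ... | inj₂ c≡0 = c≢0 c≡0
  expand : ∀ l → Σℤ (λ k → c′ k ℤ.* u k l) ≡
    ℤ.- S ℤ.* u p l ℤ.+ Σℤ (λ k → a ℤ.* c k ℤ.* w k l)
  expand l = trans (ℤΣ.sum-remove {i = p} (λ k → c′ k ℤ.* u k l))
    (cong₂ ℤ._+_ (cong (ℤ._* u p l) c′-p)
      (ℤΣ.sum-cong-≗ (λ k → cong (ℤ._* w k l) (c′-punchIn k))))
  rel′ : IntegerRelation u c′
  rel′ zero = begin
    Σℤ (λ k → c′ k ℤ.* u k zero)
      ≡⟨ expand zero ⟩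
    ℤ.- S ℤ.* a ℤ.+ Σℤ (λ k → a ℤ.* c k ℤ.* w k zero)
      ≡⟨ cong (λ z → ℤ.- S ℤ.* a ℤ.+ z) (ℤΣ.sum-cong-≗ (λ k → ℤ.*-assoc a (c k) (w k zero))) ⟩
    ℤ.- S ℤ.* a ℤ.+ Σℤ (λ k → a ℤ.* (c k ℤ.* w k zero))
      ≡⟨ cong (λ z → ℤ.- S ℤ.* a ℤ.+ z) (ℤΣ.*-distribˡ-sum a (λ k → c k ℤ.* w k zero)) ⟨
    ℤ.- S ℤ.* a ℤ.+ a ℤ.* S
      ≡⟨ cancel S a ⟩
    0ℤ ∎
    where
    cancel : ∀ S a → ℤ.- S ℤ.* a ℤ.+ a ℤ.* S ≡ 0ℤ
    cancel = ℤ-solve-∀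
  rel′ (suc l) = begin
    Σℤ (λ k → c′ k ℤ.* u k (suc l))
      ≡⟨ expand (suc l) ⟩
    ℤ.- S ℤ.* b ℤ.+ Σℤ (λ k → a ℤ.* c k ℤ.* w k (suc l))
      ≡⟨ cong (λ z → ℤ.- S ℤ.* b ℤ.+ z) (ℤΣ.sum-cong-≗ (λ k → split a b (c k) (w k zero) (w k (suc l)))) ⟩
    ℤ.- S ℤ.* b ℤ.+ Σℤ (λ k → c k ℤ.* (a ℤ.* w k (suc l) ℤ.- w k zero ℤ.* b) ℤ.+ b ℤ.* (c k ℤ.* w k zero))
      ≡⟨ cong (λ z → ℤ.- S ℤ.* b ℤ.+ z) (ℤΣ.∑-distrib-+ (λ k → c k ℤ.* (a ℤ.* w k (suc l) ℤ.- w k zero ℤ.* b)) (λ k → b ℤ.* (c k ℤ.* w k zero))) ⟩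
    ℤ.- S ℤ.* b ℤ.+ (Σℤ (λ k → c k ℤ.* (a ℤ.* w k (suc l) ℤ.- w k zero ℤ.* b)) ℤ.+ Σℤ (λ k → b ℤ.* (c k ℤ.* w k zero)))
      ≡⟨ cong₂ (λ X Y → ℤ.- S ℤ.* b ℤ.+ (X ℤ.+ Y)) (rel l)
           (sym (ℤΣ.*-distribˡ-sum b (λ k → c k ℤ.* w k zero))) ⟩
    ℤ.- S ℤ.* b ℤ.+ (0ℤ ℤ.+ b ℤ.* S)
      ≡⟨ cancel S b ⟩
    0ℤ ∎
    where
    b = u p (suc l)
    cancel : ∀ S b → ℤ.- S ℤ.* b ℤ.+ (0ℤ ℤ.+ b ℤ.* S) ≡ 0ℤ
    cancel = ℤ-solve-∀
    split : ∀ a b c w₀ w₁ → a ℤ.* c ℤ.* w₁ ≡ c ℤ.* (a ℤ.* w₁ ℤ.- w₀ ℤ.* b) ℤ.+ b ℤ.* (c ℤ.* w₀)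
    split = ℤ-solve-∀

-- Extremal slopes and residues

least : ∀ {n} {P : Fin n → Set} (P? : Decidable P) (_≼_ : Fin n → Fin n → Set) →
  (∀ i j → i ≼ j ⊎ j ≼ i) → (∀ {i j k} → i ≼ j → j ≼ k → i ≼ k) →
  ∃ P → ∃ λ i → P i × (∀ k → P k → i ≼ k)
least {suc n} {P} P? _≼_ total trans′ (k₀ , Pk₀) with Fin.any? (P? ∘ suc)
... | no ¬P⁺ = zero , P₀ k₀ Pk₀ , minimal
  where
  P₀ : ∀ k → P k → P zero
  P₀ zero    Pk = Pk
  P₀ (suc k) Pk = contradiction (k , Pk) ¬P⁺
  minimal : ∀ k → P k → zero ≼ k
  minimal zero    _  with total zero zero
  ... | inj₁ p = p
  ... | inj₂ p = p
  minimal (suc k) Pk = contradiction (k , Pk) ¬P⁺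
... | yes ∃P⁺ with least (P? ∘ suc) (λ i j → suc i ≼ suc j) (λ i j → total (suc i) (suc j)) trans′ ∃P⁺
...   | i , Pi , i≼ with P? zero | total zero (suc i)
...     | yes P₀ | inj₁ 0≼i = zero , P₀ , minimal
  where
  minimal : ∀ k → P k → zero ≼ k
  minimal zero    _  with total zero zero
  ... | inj₁ p = p
  ... | inj₂ p = p
  minimal (suc k) Pk = trans′ 0≼i (i≼ k Pk)
...     | yes P₀ | inj₂ i≼0 = suc i , Pi , λ { zero _ → i≼0 ; (suc k) → i≼ k }
...     | no ¬P₀ | _ = suc i , Pi , λ { zero P₀ → contradiction P₀ ¬P₀ ; (suc k) → i≼ k }

module Slopes {n} (A V : Vector ℤ n) (V>0 : ∀ k → ℤ.Positive (V k)) where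

  open ℤ.≤-Reasoning

  -- The order of the slopes A i / V i, cross-multiplied; positivity of `V` keeps the direction of
  -- the inequality.
  _≼_ : Fin n → Fin n → Set
  i ≼ j = A i ℤ.* V j ℤ.≤ A j ℤ.* V i

  scale : ∀ k {x y} → x ℤ.≤ y → x ℤ.* V k ℤ.≤ y ℤ.* V k
  scale k = ℤ.*-monoʳ-≤-nonNeg (V k) {{ℤ.nonNegative (ℤ.<⇒≤ (ℤ.positive⁻¹ (V k) {{V>0 k}}))}}

  swap : ∀ a b c → a ℤ.* b ℤ.* c ≡ a ℤ.* c ℤ.* b
  swap = ℤ-solve-∀

  ≼-total : ∀ i j → i ≼ j ⊎ j ≼ i
  ≼-total i j = ℤ.≤-total (A i ℤ.* V j) (A j ℤ.* V i)

  ≼-trans : ∀ {i j k} → i ≼ j → j ≼ k → i ≼ k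
  ≼-trans {i} {j} {k} i≼j j≼k = ℤ.*-cancelʳ-≤-pos _ _ (V j) {{V>0 j}} $ begin
    A i ℤ.* V k ℤ.* V j  ≡⟨ swap (A i) (V k) (V j) ⟩
    A i ℤ.* V j ℤ.* V k  ≤⟨ scale k i≼j ⟩
    A j ℤ.* V i ℤ.* V k  ≡⟨ swap (A j) (V i) (V k) ⟩
    A j ℤ.* V k ℤ.* V i  ≤⟨ scale i j≼k ⟩
    A k ℤ.* V j ℤ.* V i  ≡⟨ swap (A k) (V j) (V i) ⟩
    A k ℤ.* V i ℤ.* V j  ∎

  _≺_ : Fin n → Fin n → Set
  i ≺ j = A i ℤ.* V j ℤ.< A j ℤ.* V i

  mediant> : ∀ {i j k} → i ≺ k → j ≼ k → (A i ℤ.+ A j) ℤ.* V k ℤ.< A k ℤ.* (V i ℤ.+ V j)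
  mediant> {i} {j} {k} i≺k j≼k = begin-strict
    (A i ℤ.+ A j) ℤ.* V k            ≡⟨ ℤ.*-distribʳ-+ (V k) (A i) (A j) ⟩
    A i ℤ.* V k ℤ.+ A j ℤ.* V k      <⟨ ℤ.+-mono-<-≤ i≺k j≼k ⟩
    A k ℤ.* V i ℤ.+ A k ℤ.* V j      ≡⟨ ℤ.*-distribˡ-+ (A k) (V i) (V j) ⟨
    A k ℤ.* (V i ℤ.+ V j)            ∎

  mediant< : ∀ {i j k} → k ≼ i → k ≺ j → A k ℤ.* (V i ℤ.+ V j) ℤ.< (A i ℤ.+ A j) ℤ.* V k
  mediant< {i} {j} {k} k≼i k≺j = begin-strict
    A k ℤ.* (V i ℤ.+ V j)            ≡⟨ ℤ.*-distribˡ-+ (A k) (V i) (V j) ⟩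
    A k ℤ.* V i ℤ.+ A k ℤ.* V j      <⟨ ℤ.+-mono-≤-< k≼i k≺j ⟩
    A i ℤ.* V k ℤ.+ A j ℤ.* V k      ≡⟨ ℤ.*-distribʳ-+ (V k) (A i) (A j) ⟨
    (A i ℤ.+ A j) ℤ.* V k            ∎

  ≺⇒≢ : ∀ {i j} → i ≺ j → i ≢ j
  ≺⇒≢ i≺j refl = ℤ.<-irrefl refl i≺j

  -- The mediant of the smallest slope A i / V i and the next larger one avoids all slopes.
  mediant-avoids-slopes : ∀ {i₀ j₀} → A i₀ ℤ.* V j₀ ≢ A j₀ ℤ.* V i₀ →
    ∃₂ λ i j → i ≢ j × (∀ k → (A i ℤ.+ A j) ℤ.* V k ≢ A k ℤ.* (V i ℤ.+ V j))
  mediant-avoids-slopes {i₀} {j₀} slopes≢ with least (U? {A = Fin n}) _≼_ ≼-total ≼-trans (i₀ , tt)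
  ... | i , _ , i≼ with Fin.any? (λ k → A i ℤ.* V k ℤ.<? A k ℤ.* V i)
  -- No slope exceeds the least one, so all slopes agree, against the assumption on `i₀` and `j₀`.
  ...   | no ¬larger = contradiction
          (ℤ.≤-antisym (≼-trans {i₀} {i} {j₀} (≼i i₀) (i≼ j₀ tt)) (≼-trans {j₀} {i} {i₀} (≼i j₀) (i≼ i₀ tt)))
          slopes≢
    where
    ≼i : ∀ k → k ≼ i
    ≼i k = ℤ.≮⇒≥ (λ i≺k → ¬larger (k , i≺k))
  ...   | yes larger with least (λ k → A i ℤ.* V k ℤ.<? A k ℤ.* V i) _≼_ ≼-total ≼-trans larger
  ...     | j , i≺j , j≼ = i , j , ≺⇒≢ i≺j , avoids
    where
    ≺j : ∀ k → k ≼ i → k ≺ j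
    ≺j k k≼i = ℤ.≰⇒> λ j≼k →
      ℤ.<⇒≱ i≺j (≼-trans {j} {k} {i} j≼k k≼i)
    avoids : ∀ k → (A i ℤ.+ A j) ℤ.* V k ≢ A k ℤ.* (V i ℤ.+ V j)
    -- A slope above the least is at least that of `j` and so exceeds the mediant; any other slope
    -- equals the least and lies below the mediant.
    avoids k with A i ℤ.* V k ℤ.<? A k ℤ.* V i
    ... | yes i≺k = ℤ.<⇒≢ (mediant> i≺k (j≼ k i≺k))
    ... | no  i⊀k = ℤ.<⇒≢ (mediant< (ℤ.≮⇒≥ i⊀k) (≺j k (ℤ.≮⇒≥ i⊀k))) ∘ sym

product-nonZero : ∀ a b → a ≢ 0ℤ → b ≢ 0ℤ → a ℤ.* b ≢ 0ℤ
product-nonZero a b a≢0 b≢0 ab≡0 with ℤ.i*j≡0⇒i≡0∨j≡0 a ab≡0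
... | inj₁ a≡0 = a≢0 a≡0
... | inj₂ b≡0 = b≢0 b≡0

+∣-∣-positive : ∀ z → z ≢ 0ℤ → ℤ.Positive (+ ℤ.∣ z ∣)
+∣-∣-positive (+ zero)  z≢0 = contradiction refl z≢0
+∣-∣-positive (+ suc _) _   = _
+∣-∣-positive -[1+ _ ]  _   = _

square-product : ∀ s t → s ℤ.* t ℤ.* (s ℤ.* t) ≡ s ℤ.* s ℤ.* (t ℤ.* t)
square-product = ℤ-solve-∀

product-unit : ∀ s t → s ℤ.* s ≡ 1ℤ → t ℤ.* t ≡ 1ℤ → s ℤ.* t ℤ.* (s ℤ.* t) ≡ 1ℤ
product-unit s t s²≡1 t²≡1 = trans (square-product s t) (cong₂ ℤ._*_ s²≡1 t²≡1)

EqualSpeeds : ∀ {n} → Vector ℤ n → Set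
EqualSpeeds v = ∃₂ λ i j → i ≢ j × ∃ λ ε → ε ℤ.* ε ≡ 1ℤ × v i ≡ ε ℤ.* v j

module Crossing {n} (a v s : Vector ℤ n) (s²≡1 : ∀ k → s k ℤ.* s k ≡ 1ℤ) where

  open ≡-Reasoning

  A V : Vector ℤ n
  A k = s k ℤ.* a k
  V k = s k ℤ.* v k

  pull : ∀ s t a v → s ℤ.* a ℤ.* (t ℤ.* v) ≡ s ℤ.* t ℤ.* (a ℤ.* v)
  pull = ℤ-solve-∀

  unsign : ∀ i j x → x ≡ s i ℤ.* s j ℤ.* (s i ℤ.* s j ℤ.* x)
  unsign i j x = from-abs (s i ℤ.* s j) x (product-unit (s i) (s j) (s²≡1 i) (s²≡1 j)) refl

  proportional : ∀ {i j} → A i ℤ.* V j ≡ A j ℤ.* V i → a i ℤ.* v j ≡ a j ℤ.* v i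
  proportional {i} {j} eq = begin
    a i ℤ.* v j
      ≡⟨ unsign i j (a i ℤ.* v j) ⟩
    s i ℤ.* s j ℤ.* (s i ℤ.* s j ℤ.* (a i ℤ.* v j))
      ≡⟨ cong (s i ℤ.* s j ℤ.*_) (pull (s i) (s j) (a i) (v j)) ⟨
    s i ℤ.* s j ℤ.* (A i ℤ.* V j)
      ≡⟨ cong (s i ℤ.* s j ℤ.*_) eq ⟩
    s i ℤ.* s j ℤ.* (A j ℤ.* V i)
      ≡⟨ cong (s i ℤ.* s j ℤ.*_) (trans (pull (s j) (s i) (a j) (v i))
           (cong (ℤ._* (a j ℤ.* v i)) (ℤ.*-comm (s j) (s i)))) ⟩
    s i ℤ.* s j ℤ.* (s i ℤ.* s j ℤ.* (a j ℤ.* v i))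
      ≡⟨ unsign i j (a j ℤ.* v i) ⟨
    a j ℤ.* v i ∎

  module _ (i j : Fin n) where

    -- λ = y / x is the point where A i + λ V i and A j + λ V j add up to 0, so that the i-th and
    -- j-th functions agree in absolute value. The k-th function vanishes at -A k / V k, so avoiding
    -- all zeros means that the mediant -λ is not a slope.
    x y : ℤ
    x = V i ℤ.+ V j
    y = ℤ.- (A i ℤ.+ A j)

    cross : ∀ x A s a v → A ℤ.* (s ℤ.* v) ℤ.+ s ℤ.* (x ℤ.* a ℤ.+ ℤ.- A ℤ.* v) ≡ s ℤ.* a ℤ.* x
    cross = ℤ-solve-∀

    nonZero : ∀ k → (A i ℤ.+ A j) ℤ.* V k ≢ A k ℤ.* x → x ℤ.* a k ℤ.+ y ℤ.* v k ≢ 0ℤ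
    nonZero k avoids eq = avoids $ begin
      A₊ ℤ.* V k
        ≡⟨ ℤ.+-identityʳ (A₊ ℤ.* V k) ⟨
      A₊ ℤ.* V k ℤ.+ 0ℤ
        ≡⟨ cong (λ z → A₊ ℤ.* V k ℤ.+ z) (trans (cong (s k ℤ.*_) eq) (ℤ.*-zeroʳ (s k))) ⟨
      A₊ ℤ.* V k ℤ.+ s k ℤ.* (x ℤ.* a k ℤ.+ y ℤ.* v k)
        ≡⟨ cross x A₊ (s k) (a k) (v k) ⟩
      A k ℤ.* x ∎
      where A₊ = A i ℤ.+ A j

    at-i : ∀ s t a b v w →
      (s ℤ.* v ℤ.+ t ℤ.* w) ℤ.* a ℤ.+ ℤ.- (s ℤ.* a ℤ.+ t ℤ.* b) ℤ.* v ≡ 1ℤ ℤ.* t ℤ.* (a ℤ.* w ℤ.- b ℤ.* v)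
    at-i = ℤ-solve-∀

    at-j : ∀ s t a b v w →
      s ℤ.* s ℤ.* t ℤ.* (a ℤ.* w ℤ.- b ℤ.* v) ≡
      ℤ.- s ℤ.* t ℤ.* ((s ℤ.* v ℤ.+ t ℤ.* w) ℤ.* b ℤ.+ ℤ.- (s ℤ.* a ℤ.+ t ℤ.* b) ℤ.* w)
    at-j = ℤ-solve-∀

    -- With D = a i v j - a j v i, the i-th entry is s j D and the j-th entry is -(s i) D.
    equal : x ℤ.* a i ℤ.+ y ℤ.* v i ≡ ℤ.- s i ℤ.* s j ℤ.* (x ℤ.* a j ℤ.+ y ℤ.* v j)
    equal = begin
      x ℤ.* a i ℤ.+ y ℤ.* v i
        ≡⟨ at-i (s i) (s j) (a i) (a j) (v i) (v j) ⟩
      1ℤ ℤ.* s j ℤ.* (a i ℤ.* v j ℤ.- a j ℤ.* v i)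
        ≡⟨ cong (λ u → u ℤ.* s j ℤ.* (a i ℤ.* v j ℤ.- a j ℤ.* v i)) (s²≡1 i) ⟨
      s i ℤ.* s i ℤ.* s j ℤ.* (a i ℤ.* v j ℤ.- a j ℤ.* v i)
        ≡⟨ at-j (s i) (s j) (a i) (a j) (v i) (v j) ⟩
      ℤ.- s i ℤ.* s j ℤ.* (x ℤ.* a j ℤ.+ y ℤ.* v j) ∎

    neg-unit : ∀ s → ℤ.- s ℤ.* ℤ.- s ≡ s ℤ.* s
    neg-unit = ℤ-solve-∀

    equalSpeeds : i ≢ j → EqualSpeeds (λ k → x ℤ.* a k ℤ.+ y ℤ.* v k)
    equalSpeeds i≢j = i , j , i≢j , ℤ.- s i ℤ.* s j ,
      product-unit (ℤ.- s i) (s j) (trans (neg-unit (s i)) (s²≡1 i)) (s²≡1 j) , equal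

-- In absolute value the affine functions a k + λ v k cross pairwise; at the crossing
-- of two functions with neighbouring zeros no other function vanishes.
equal-speeds : ∀ {n} (a v : Vector ℤ n) → (∀ k → v k ≢ 0ℤ) →
  ∀ {i j} → a i ℤ.* v j ≢ a j ℤ.* v i →
  ∃₂ λ x y → (∀ k → x ℤ.* a k ℤ.+ y ℤ.* v k ≢ 0ℤ) ×
    EqualSpeeds (λ k → x ℤ.* a k ℤ.+ y ℤ.* v k)
equal-speeds {n} a v v≢0 a∦v =
  let i , j , i≢j , avoids =
        Slopes.mediant-avoids-slopes A V V>0 (λ eq → a∦v (proportional eq))
  in x i j , y i j , (λ k → nonZero i j k (avoids k)) , equalSpeeds i j i≢j
  where
  s : Vector ℤ n
  s k = proj₁ (unit-sign (v k))
  open Crossing a v s (λ k → proj₁ (proj₂ (unit-sign (v k))))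
  V>0 : ∀ k → ℤ.Positive (V k)
  V>0 k = subst ℤ.Positive (sym (proj₂ (proj₂ (unit-sign (v k))))) (+∣-∣-positive (v k) (v≢0 k))

-- `funToFin` numbers the residue vectors below N^d, which brings the pigeonhole principle to bear.
-- The vector `w` is the difference of the quotients; were it zero, the two points would agree,
-- against injectivity.
congruent-pair : ∀ N .{{_ : ℕ.NonZero N}} {k d} → N ℕ.^ d ℕ.< k →
  (p : Fin k → Vector ℤ d) → Injective _≡_ _≗_ p →
  ∃₂ λ i j → ∃ λ (w : Vector ℤ d) →
    (∃ λ l → w l ≢ 0ℤ) × (∀ l → p i l ≡ p j l ℤ.+ w l ℤ.* + N)
congruent-pair N {k} {d} N^d<k p p-injective
  with Fin.pigeonhole N^d<k (λ i → funToFin (residue i))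
  where
  residue : Fin k → Fin d → Fin N
  residue i l = fromℕ< (ℤ.n%ℕd<d (p i l) N)
... | i , j , i<j , eq = i , j , w , w≢0 , congruent
  where
  open ≡-Reasoning
  w : Vector ℤ d
  w l = (p i l ℤ./ℕ N) ℤ.- (p j l ℤ./ℕ N)
  residues≡ : ∀ l → p i l ℤ.%ℕ N ≡ p j l ℤ.%ℕ N
  residues≡ l = Fin.fromℕ<-injective _ _ _ _ $ begin
    fromℕ< (ℤ.n%ℕd<d (p i l) N)
      ≡⟨ Fin.finToFun-funToFin (λ l → fromℕ< (ℤ.n%ℕd<d (p i l) N)) l ⟨
    finToFun (funToFin (λ l → fromℕ< (ℤ.n%ℕd<d (p i l) N))) l
      ≡⟨ cong (λ f → finToFun {N} {d} f l) eq ⟩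
    finToFun (funToFin (λ l → fromℕ< (ℤ.n%ℕd<d (p j l) N))) l
      ≡⟨ Fin.finToFun-funToFin (λ l → fromℕ< (ℤ.n%ℕd<d (p j l) N)) l ⟩
    fromℕ< (ℤ.n%ℕd<d (p j l) N) ∎
  regroup : ∀ r a b N → r ℤ.+ a ℤ.* N ≡ r ℤ.+ b ℤ.* N ℤ.+ (a ℤ.- b) ℤ.* N
  regroup = ℤ-solve-∀
  congruent : ∀ l → p i l ≡ p j l ℤ.+ w l ℤ.* + N
  congruent l = begin
    p i l
      ≡⟨ ℤ.a≡a%ℕn+[a/ℕn]*n (p i l) N ⟩
    + (p i l ℤ.%ℕ N) ℤ.+ (p i l ℤ./ℕ N) ℤ.* + N
      ≡⟨ cong (λ r → + r ℤ.+ (p i l ℤ./ℕ N) ℤ.* + N) (residues≡ l) ⟩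
    + (p j l ℤ.%ℕ N) ℤ.+ (p i l ℤ./ℕ N) ℤ.* + N
      ≡⟨ regroup (+ (p j l ℤ.%ℕ N)) (p i l ℤ./ℕ N) (p j l ℤ./ℕ N) (+ N) ⟩
    + (p j l ℤ.%ℕ N) ℤ.+ (p j l ℤ./ℕ N) ℤ.* + N ℤ.+ w l ℤ.* + N
      ≡⟨ cong (ℤ._+ w l ℤ.* + N) (ℤ.a≡a%ℕn+[a/ℕn]*n (p j l) N) ⟨
    p j l ℤ.+ w l ℤ.* + N ∎
  equal-if-w≡0 : (∀ l → w l ≡ 0ℤ) → p i ≗ p j
  equal-if-w≡0 w≡0 l = begin
    p i l                    ≡⟨ congruent l ⟩
    p j l ℤ.+ w l ℤ.* + N    ≡⟨ cong (λ z → p j l ℤ.+ z ℤ.* + N) (w≡0 l) ⟩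
    p j l ℤ.+ 0ℤ ℤ.* + N     ≡⟨ cong (λ z → p j l ℤ.+ z) (ℤ.*-zeroˡ (+ N)) ⟩
    p j l ℤ.+ 0ℤ             ≡⟨ ℤ.+-identityʳ (p j l) ⟩
    p j l                    ∎
  w≢0 : ∃ λ l → w l ≢ 0ℤ
  w≢0 = Fin.¬∀⟶∃¬ d (λ l → w l ≡ 0ℤ) (λ l → w l ℤ.≟ 0ℤ)
    (λ w≡0 → Fin.<⇒≢ i<j (p-injective (equal-if-w≡0 w≡0)))

-- Induction by Pascal's rule, with the binomial doubled to avoid a division in ℕ.
twice-binomial : ∀ n → 2 ℕ.* (suc n C 2) ≡ n ℕ.* suc n
twice-binomial zero    = refl
twice-binomial (suc n) = begin
  2 ℕ.* (suc (suc n) C 2)              ≡⟨ cong (2 ℕ.*_) (nCk+nC[k+1]≡[n+1]C[k+1] (suc n) 1) ⟨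
  2 ℕ.* (suc n C 1 ℕ.+ suc n C 2)      ≡⟨ ℕ.*-distribˡ-+ 2 (suc n C 1) (suc n C 2) ⟩
  2 ℕ.* (suc n C 1) ℕ.+ 2 ℕ.* (suc n C 2)
    ≡⟨ cong₂ (λ a b → 2 ℕ.* a ℕ.+ b) (nC1≡n (suc n)) (twice-binomial n) ⟩
  2 ℕ.* suc n ℕ.+ n ℕ.* suc n          ≡⟨ ℕ.*-distribʳ-+ (suc n) 2 n ⟨
  (2 ℕ.+ n) ℕ.* suc n                  ≡⟨ ℕ.*-comm (2 ℕ.+ n) (suc n) ⟩
  suc n ℕ.* suc (suc n)                ∎
  where open ≡-Reasoning

-- Rational numbers and limits of rational sequences

ℚ-ring : AlmostCommutativeRing 0ℓ 0ℓ
ℚ-ring = fromCommutativeRing ℚ.+-*-commutativeRing (λ q → dec⇒maybe (0ℚ ℚ.≟ q))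

module ℚΣ = SemiringSum (CommutativeRing.semiring ℚ.+-*-commutativeRing)

Σℚ : ∀ {n} → Vector ℚ n → ℚ
Σℚ = ℚΣ.sum

⟦_⟧ : ℤ → ℚ
⟦ z ⟧ = z ℚ./ 1

-- Confines the reduction of fractions to lowest terms to one place: the identities below are
-- checked on unnormalised fractions.
/-≃ : ∀ a k → ℚ.toℚᵘ (a ℚ./ suc k) ℚᵘ.≃ mkℚᵘ a k
/-≃ a k = ℚ.toℚᵘ-fromℚᵘ (mkℚᵘ a k)

⟦⟧-+ : ∀ a b → ⟦ a ℤ.+ b ⟧ ≡ ⟦ a ⟧ ℚ.+ ⟦ b ⟧
⟦⟧-+ a b = ℚ.toℚᵘ-injective $ begin
  ℚ.toℚᵘ ⟦ a ℤ.+ b ⟧               ≈⟨ /-≃ (a ℤ.+ b) 0 ⟩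
  mkℚᵘ (a ℤ.+ b) 0                 ≈⟨ *≡* (cong (ℤ._* 1ℤ) (cong₂ ℤ._+_ (ℤ.*-identityʳ a) (ℤ.*-identityʳ b))) ⟨
  mkℚᵘ a 0 ℚᵘ.+ mkℚᵘ b 0           ≈⟨ ℚᵘ.+-cong (/-≃ a 0) (/-≃ b 0) ⟨
  ℚ.toℚᵘ ⟦ a ⟧ ℚᵘ.+ ℚ.toℚᵘ ⟦ b ⟧   ≈⟨ ℚ.toℚᵘ-homo-+ ⟦ a ⟧ ⟦ b ⟧ ⟨
  ℚ.toℚᵘ (⟦ a ⟧ ℚ.+ ⟦ b ⟧)         ∎
  where open ℚᵘ.≃-Reasoning

⟦⟧-* : ∀ a b → ⟦ a ℤ.* b ⟧ ≡ ⟦ a ⟧ ℚ.* ⟦ b ⟧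
⟦⟧-* a b = ℚ.toℚᵘ-injective $ begin
  ℚ.toℚᵘ ⟦ a ℤ.* b ⟧               ≈⟨ /-≃ (a ℤ.* b) 0 ⟩
  mkℚᵘ a 0 ℚᵘ.* mkℚᵘ b 0           ≈⟨ ℚᵘ.*-cong (/-≃ a 0) (/-≃ b 0) ⟨
  ℚ.toℚᵘ ⟦ a ⟧ ℚᵘ.* ℚ.toℚᵘ ⟦ b ⟧   ≈⟨ ℚ.toℚᵘ-homo-* ⟦ a ⟧ ⟦ b ⟧ ⟨
  ℚ.toℚᵘ (⟦ a ⟧ ℚ.* ⟦ b ⟧)         ∎
  where open ℚᵘ.≃-Reasoning

⟦⟧-neg : ∀ a → ⟦ ℤ.- a ⟧ ≡ ℚ.- ⟦ a ⟧
⟦⟧-neg a = ℚ.toℚᵘ-injective $ begin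
  ℚ.toℚᵘ ⟦ ℤ.- a ⟧       ≈⟨ /-≃ (ℤ.- a) 0 ⟩
  ℚᵘ.- mkℚᵘ a 0          ≈⟨ ℚᵘ.-‿cong (/-≃ a 0) ⟨
  ℚᵘ.- ℚ.toℚᵘ ⟦ a ⟧      ≈⟨ ℚ.toℚᵘ-homo‿- ⟦ a ⟧ ⟨
  ℚ.toℚᵘ (ℚ.- ⟦ a ⟧)     ∎
  where open ℚᵘ.≃-Reasoning

⟦⟧≡0 : ∀ a → ⟦ a ⟧ ≡ 0ℚ → a ≡ 0ℤ
⟦⟧≡0 a eq with ℚᵘ.≃-trans (ℚᵘ.≃-sym (/-≃ a 0)) (ℚ.toℚᵘ-cong eq)
... | *≡* a*1≡0 = trans (sym (ℤ.*-identityʳ a)) a*1≡0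

⟦⟧-Σ : ∀ {n} (f : Vector ℤ n) → ⟦ Σℤ f ⟧ ≡ Σℚ (λ i → ⟦ f i ⟧)
⟦⟧-Σ {zero}  f = refl
⟦⟧-Σ {suc n} f = trans (⟦⟧-+ (f zero) (Σℤ (f ∘ suc))) (cong (⟦ f zero ⟧ ℚ.+_) (⟦⟧-Σ (f ∘ suc)))

⟦⟧-Σ* : ∀ {n} (f g : Vector ℤ n) → ⟦ Σℤ (λ i → f i ℤ.* g i) ⟧ ≡ Σℚ (λ i → ⟦ f i ⟧ ℚ.* ⟦ g i ⟧)
⟦⟧-Σ* f g = trans (⟦⟧-Σ (λ i → f i ℤ.* g i)) (ℚΣ.sum-cong-≗ (λ i → ⟦⟧-* (f i) (g i)))

1/suc : ℕ → ℚ
1/suc k = + 1 ℚ./ suc k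

/-as-* : ∀ a k → a ℚ./ suc k ≡ ⟦ a ⟧ ℚ.* 1/suc k
/-as-* a k = ℚ.toℚᵘ-injective $ begin
  ℚ.toℚᵘ (a ℚ./ suc k)                ≈⟨ /-≃ a k ⟩
  mkℚᵘ a k                            ≈⟨ *≡* (cong₂ ℤ._*_ (sym (ℤ.*-identityʳ a)) (cong +_ (ℕ.+-identityʳ (suc k)))) ⟩
  mkℚᵘ a 0 ℚᵘ.* mkℚᵘ (+ 1) k          ≈⟨ ℚᵘ.*-cong (/-≃ a 0) (/-≃ (+ 1) k) ⟨
  ℚ.toℚᵘ ⟦ a ⟧ ℚᵘ.* ℚ.toℚᵘ (1/suc k)  ≈⟨ ℚ.toℚᵘ-homo-* ⟦ a ⟧ (1/suc k) ⟨
  ℚ.toℚᵘ (⟦ a ⟧ ℚ.* 1/suc k)          ∎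
  where open ℚᵘ.≃-Reasoning

suc*1/suc : ∀ k → ⟦ + suc k ⟧ ℚ.* 1/suc k ≡ 1ℚ
suc*1/suc k = trans (sym (/-as-* (+ suc k) k)) $ ℚ.toℚᵘ-injective $
  ℚᵘ.≃-trans (/-≃ (+ suc k) k) (*≡* (ℤ.*-comm (+ suc k) 1ℤ))

0≤1/suc : ∀ k → 0ℚ ℚ.≤ 1/suc k
0≤1/suc k = ℚ.nonNegative⁻¹ (1/suc k) {{ℚ.normalize-nonNeg 1 (suc k)}}

floor-bounds : ∀ p → ⟦ ℚ.floor p ⟧ ℚ.≤ p × p ℚ.≤ ⟦ ℚ.floor p ⟧ ℚ.+ 1ℚ
floor-bounds p@record{} = ℚ.toℚᵘ-cancel-≤ lower , subst (p ℚ.≤_) (⟦⟧-+ q 1ℤ) (ℚ.toℚᵘ-cancel-≤ upper)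
  where
  d = ℚ.↧ p
  q = ℚ.floor p
  lower : ℚ.toℚᵘ ⟦ q ⟧ ℚᵘ.≤ ℚ.toℚᵘ p
  lower = ℚᵘ.≤-respˡ-≃ (ℚᵘ.≃-sym (/-≃ q 0))
    (*≤* (subst (q ℤ.* d ℤ.≤_) (sym (ℤ.*-identityʳ (ℚ.↥ p))) (ℤ.[n/d]*d≤n (ℚ.↥ p) d)))
  upper : ℚ.toℚᵘ p ℚᵘ.≤ ℚ.toℚᵘ ⟦ q ℤ.+ 1ℤ ⟧
  upper = ℚᵘ.≤-respʳ-≃ (ℚᵘ.≃-sym (/-≃ (q ℤ.+ 1ℤ) 0)) (*≤* (begin
    ℚ.↥ p ℤ.* 1ℤ                            ≡⟨ ℤ.*-identityʳ (ℚ.↥ p) ⟩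
    ℚ.↥ p                                   ≡⟨ ℤ.a≡a%n+[a/n]*n (ℚ.↥ p) d ⟩
    + (ℚ.↥ p ℤ.% d) ℤ.+ q ℤ.* d             ≤⟨ ℤ.+-monoˡ-≤ (q ℤ.* d) (ℤ.+≤+ (ℕ.<⇒≤ (ℤ.n%d<d (ℚ.↥ p) d))) ⟩
    d ℤ.+ q ℤ.* d                           ≡⟨ ℤ.suc-* q d ⟨
    ℤ.suc q ℤ.* d                           ≡⟨ cong (ℤ._* d) (ℤ.+-comm 1ℤ q) ⟩
    (q ℤ.+ 1ℤ) ℤ.* d                        ∎))
    where open ℤ.≤-Reasoning

0≤diff : ∀ {p q} → p ℚ.≤ q → 0ℚ ℚ.≤ q ℚ.- p
0≤diff {p} {q} p≤q = subst (ℚ._≤ q ℚ.- p) (ℚ.+-inverseʳ p) (ℚ.+-monoˡ-≤ (ℚ.- p) p≤q)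

0≤diff⁻¹ : ∀ {p q} → 0ℚ ℚ.≤ q ℚ.- p → p ℚ.≤ q
0≤diff⁻¹ {p} {q} 0≤ = subst₂ ℚ._≤_ (ℚ.+-identityˡ p) (restore q p) (ℚ.+-monoˡ-≤ p 0≤)
  where
  restore : ∀ q p → q ℚ.- p ℚ.+ p ≡ q
  restore = solve-∀ ℚ-ring

0≤-* : ∀ {p q} → 0ℚ ℚ.≤ p → 0ℚ ℚ.≤ q → 0ℚ ℚ.≤ p ℚ.* q
0≤-* {p} {q} 0≤p 0≤q = ℚ.nonNegative⁻¹ (p ℚ.* q)
  {{ℚ.nonNeg*nonNeg⇒nonNeg p {{ℚ.nonNegative 0≤p}} q {{ℚ.nonNegative 0≤q}}}}

0≤-neg : ∀ {p} → p ℚ.≤ 0ℚ → 0ℚ ℚ.≤ ℚ.- p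
0≤-neg = ℚ.neg-antimono-≤

-- All relations between reals are expressed by lim sup s ≤ 0 or lim s = 0 for rational
-- sequences s, so that the algebra takes place in ℚ.
infix 4 _≲0 _~0

_≲0 : (ℕ → ℚ) → Set
s ≲0 = ∀ ε → 0ℚ ℚ.< ε → Eventually λ n → s n ℚ.≤ ε

_~0 : (ℕ → ℚ) → Set
s ~0 = s ≲0 × (λ n → ℚ.- s n) ≲0

≲0-cong : ∀ {s t} → s ≗ t → s ≲0 → t ≲0
≲0-cong s≗t s≲0 ε 0<ε with s≲0 ε 0<ε
... | N , h = N , λ n N≤n → subst (ℚ._≤ ε) (s≗t n) (h n N≤n)

≲0-+ : ∀ {s t} → s ≲0 → t ≲0 → (λ n → s n ℚ.+ t n) ≲0
≲0-+ s≲0 t≲0 ε 0<ε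
  with s≲0 (½ ℚ.* ε) (Defs.positive-½ ε 0<ε) | t≲0 (½ ℚ.* ε) (Defs.positive-½ ε 0<ε)
... | M , hM | N , hN = M ℕ.⊔ N , λ n p →
  subst (_ ℚ.≤_) (Defs.½+½ ε)
    (ℚ.+-mono-≤ (hM n (ℕ.m⊔n≤o⇒m≤o M N p)) (hN n (ℕ.m⊔n≤o⇒n≤o M N p)))

≲0-const : ∀ {q} → q ℚ.≤ 0ℚ → (λ _ → q) ≲0
≲0-const q≤0 ε 0<ε = 0 , λ _ _ → ℚ.≤-trans q≤0 (ℚ.<⇒≤ 0<ε)

-- A positive `q` would exceed some ε strictly between 0 and `q`. This is how inequalities between
-- rationals are recovered from limits.
≲0-const⁻¹ : ∀ {q} → (λ _ → q) ≲0 → q ℚ.≤ 0ℚ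
≲0-const⁻¹ {q} q≲0 = ℚ.≮⇒≥ λ 0<q →
  let ε , 0<ε , ε<q = ℚ.<-dense 0<q
      N , h = q≲0 ε 0<ε
  in ℚ.<-irrefl refl (ℚ.<-≤-trans ε<q (h N ℕ.≤-refl))

≲0-scale : ∀ {q s} → 0ℚ ℚ.≤ q → s ≲0 → (λ n → q ℚ.* s n) ≲0
≲0-scale {q} {s} 0≤q s≲0 ε 0<ε =
  -- Dividing by `q + 1` instead of `q` covers the case q = 0.
  let δ , 0<δ , δ[q+1]≡ε = quotient ε (q ℚ.+ 1ℚ) 0<ε (ℚ.nonNeg+pos⇒pos q {{ℚ.nonNegative 0≤q}} 1ℚ)
      N , h = s≲0 δ 0<δ
  in N , λ n N≤n → begin
    q ℚ.* s n           ≤⟨ ℚ.*-monoˡ-≤-nonNeg q {{ℚ.nonNegative 0≤q}} (h n N≤n) ⟩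
    q ℚ.* δ             ≡⟨ ℚ.+-identityʳ (q ℚ.* δ) ⟨
    q ℚ.* δ ℚ.+ 0ℚ      ≤⟨ ℚ.+-monoʳ-≤ (q ℚ.* δ) (ℚ.<⇒≤ 0<δ) ⟩
    q ℚ.* δ ℚ.+ δ       ≡⟨ expand q δ ⟩
    δ ℚ.* (q ℚ.+ 1ℚ)    ≡⟨ δ[q+1]≡ε ⟩
    ε                   ∎
  where
  open ℚ.≤-Reasoning
  expand : ∀ q δ → q ℚ.* δ ℚ.+ δ ≡ δ ℚ.* (q ℚ.+ 1ℚ)
  expand = solve-∀ ℚ-ring

~0-cong : ∀ {s t} → s ≗ t → s ~0 → t ~0
~0-cong s≗t (s≲0 , -s≲0) = ≲0-cong s≗t s≲0 , ≲0-cong (cong ℚ.-_ ∘ s≗t) -s≲0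

~0-+ : ∀ {s t} → s ~0 → t ~0 → (λ n → s n ℚ.+ t n) ~0
~0-+ {s} {t} (s≲0 , -s≲0) (t≲0 , -t≲0) =
  ≲0-+ s≲0 t≲0 , ≲0-cong (λ n → sym (ℚ.neg-distrib-+ (s n) (t n))) (≲0-+ -s≲0 -t≲0)

~0-neg : ∀ {s} → s ~0 → (λ n → ℚ.- s n) ~0
~0-neg {s} (s≲0 , -s≲0) = -s≲0 , ≲0-cong (λ n → sym (neg-neg (s n))) s≲0
  where
  neg-neg : ∀ a → ℚ.- ℚ.- a ≡ a
  neg-neg = solve-∀ ℚ-ring

~0-scale : ∀ q {s} → s ~0 → (λ n → q ℚ.* s n) ~0
~0-scale q {s} (s≲0 , -s≲0) with ℚ.≤-total 0ℚ q
... | inj₁ 0≤q = ≲0-scale 0≤q s≲0 ,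
  ≲0-cong (λ n → sym (ℚ.neg-distribʳ-* q (s n))) (≲0-scale 0≤q -s≲0)
... | inj₂ q≤0 = ≲0-cong (λ n → neg*neg q (s n)) (≲0-scale (0≤-neg q≤0) -s≲0) ,
  ≲0-cong (λ n → sym (ℚ.neg-distribˡ-* q (s n))) (≲0-scale (0≤-neg q≤0) s≲0)
  where
  neg*neg : ∀ a b → ℚ.- a ℚ.* ℚ.- b ≡ a ℚ.* b
  neg*neg = solve-∀ ℚ-ring

~0-0 : (λ _ → 0ℚ) ~0
~0-0 = ≲0-const ℚ.≤-refl , ≲0-const ℚ.≤-refl

~0-Σ : ∀ {k} {s : Fin k → ℕ → ℚ} → (∀ i → s i ~0) → (λ n → Σℚ (λ i → s i n)) ~0
~0-Σ {zero}  s~0 = ~0-0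
~0-Σ {suc k} s~0 = ~0-+ (s~0 zero) (~0-Σ (s~0 ∘ suc))

≤⇒≲0 : ∀ {x y} → x ≤ y → (λ n → seq x n ℚ.- seq y n) ≲0
≤⇒≲0 {x} {y} x≤y ε 0<ε with x≤y ε 0<ε
... | N , h = N , λ n N≤n → subst (_ ℚ.≤_) (cancel (seq y n) ε) (ℚ.+-monoˡ-≤ (ℚ.- seq y n) (h n N≤n))
  where
  cancel : ∀ y ε → y ℚ.+ ε ℚ.- y ≡ ε
  cancel = solve-∀ ℚ-ring

≲0⇒≤ : ∀ {x y} → (λ n → seq x n ℚ.- seq y n) ≲0 → x ≤ y
≲0⇒≤ {x} {y} x-y≲0 ε 0<ε with x-y≲0 ε 0<ε
... | N , h = N , λ n N≤n →
  subst (ℚ._≤ _) (cancel (seq x n) (seq y n)) (ℚ.+-monoʳ-≤ (seq y n) (h n N≤n))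
  where
  cancel : ∀ x y → y ℚ.+ (x ℚ.- y) ≡ x
  cancel = solve-∀ ℚ-ring

p≤∣p∣ : ∀ p → p ℚ.≤ ℚ.∣ p ∣
p≤∣p∣ p with ℚ.≤-total 0ℚ p
... | inj₁ 0≤p = ℚ.≤-reflexive (sym (ℚ.0≤p⇒∣p∣≡p 0≤p))
... | inj₂ p≤0 = ℚ.≤-trans p≤0 (ℚ.0≤∣p∣ p)

≈⇒~0 : ∀ {x y} → x ≈ y → (λ n → seq x n ℚ.- seq y n) ~0
≈⇒~0 x≈y =
  (λ ε 0<ε → let N , h = x≈y ε 0<ε in N , λ n p → ℚ.≤-trans (p≤∣p∣ _) (h n p)) ,
  (λ ε 0<ε → let N , h = x≈y ε 0<ε in N , λ n p →
    ℚ.≤-trans (p≤∣p∣ _) (subst (ℚ._≤ ε) (sym (ℚ.∣-p∣≡∣p∣ _)) (h n p)))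

~0⇒≈ : ∀ {x y} → (λ n → seq x n ℚ.- seq y n) ~0 → x ≈ y
~0⇒≈ {x} {y} (x-y≲0 , y-x≲0) ε 0<ε with x-y≲0 ε 0<ε | y-x≲0 ε 0<ε
... | M , hM | N , hN = M ℕ.⊔ N , bound
  where
  bound : ∀ n → M ℕ.⊔ N ℕ.≤ n → ℚ.∣ seq x n ℚ.- seq y n ∣ ℚ.≤ ε
  bound n p with ℚ.∣p∣≡p∨∣p∣≡-p (seq x n ℚ.- seq y n)
  ... | inj₁ eq = subst (ℚ._≤ ε) (sym eq) (hM n (ℕ.m⊔n≤o⇒m≤o M N p))
  ... | inj₂ eq = subst (ℚ._≤ ε) (sym eq) (hN n (ℕ.m⊔n≤o⇒n≤o M N p))

seq-sum : ∀ {k} (f : Vector ℝ k) n → seq (Defs.sum f) n ≡ Σℚ (λ i → seq (f i) n)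
seq-sum {zero}  f n = refl
seq-sum {suc k} f n = cong (seq (f zero) n ℚ.+_) (seq-sum (f ∘ suc) n)

-- Zonotopes with a prescribed linear dependence

-- If `σ` were onto, choosing preimages would inject `suc m` elements into `m`.
missed-index : ∀ {m} (σ : Fin m → Fin (suc m)) → ∃ λ j → ∀ k → σ k ≢ j
missed-index {m} σ =
  let j , j∉σ = Fin.¬∀⟶∃¬ (suc m) (λ j → ∃ λ k → σ k ≡ j) (λ j → Fin.any? (λ k → σ k Fin.≟ j)) not-onto
  in j , λ k σk≡j → j∉σ (k , σk≡j)
  where
  not-onto : ¬ (∀ j → ∃ λ k → σ k ≡ j)
  not-onto onto =
    let i , j , i<j , eq = Fin.pigeonhole (ℕ.n<1+n m) (proj₁ ∘ onto)
    in Fin.<⇒≢ i<j (trans (sym (proj₂ (onto i))) (trans (cong σ eq) (proj₂ (onto j))))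

δ-diagonal : ∀ {n} (i : Fin n) → δ i i ≡ 1ℤ
δ-diagonal zero    = refl
δ-diagonal (suc i) = δ-diagonal i

δ-off-diagonal : ∀ {n} {i j : Fin n} → i ≢ j → δ i j ≡ 0ℤ
δ-off-diagonal {i = zero}  {zero}  i≢j = contradiction refl i≢j
δ-off-diagonal {i = zero}  {suc j} i≢j = refl
δ-off-diagonal {i = suc i} {zero}  i≢j = refl
δ-off-diagonal {i = suc i} {suc j} i≢j = δ-off-diagonal (i≢j ∘ cong suc)

Σℚ-zero : ∀ {n} {f : Vector ℚ n} → (∀ i → f i ≡ 0ℚ) → Σℚ f ≡ 0ℚ
Σℚ-zero {n} f≡0 = trans (ℚΣ.sum-cong-≗ f≡0) (ℚΣ.sum-replicate-zero n)

Σℚ-δ-missed : ∀ {k n} (c : Vector ℚ k) (σ : Fin k → Fin n) {i} → (∀ j → σ j ≢ i) →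
  Σℚ (λ j → c j ℚ.* ⟦ δ i (σ j) ⟧) ≡ 0ℚ
Σℚ-δ-missed c σ i∉σ = Σℚ-zero λ j →
  trans (cong (λ z → c j ℚ.* ⟦ z ⟧) (δ-off-diagonal (i∉σ j ∘ sym))) (ℚ.*-zeroʳ (c j))

Σℚ-δ-hit : ∀ {k n} (c : Vector ℚ k) (σ : Fin k → Fin n) → Injective _≡_ _≡_ σ → ∀ j₀ →
  Σℚ (λ j → c j ℚ.* ⟦ δ (σ j₀) (σ j) ⟧) ≡ c j₀
Σℚ-δ-hit {suc k} c σ σ-injective j₀ = begin
  Σℚ (λ j → c j ℚ.* ⟦ δ (σ j₀) (σ j) ⟧)
    ≡⟨ ℚΣ.sum-remove {i = j₀} (λ j → c j ℚ.* ⟦ δ (σ j₀) (σ j) ⟧) ⟩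
  c j₀ ℚ.* ⟦ δ (σ j₀) (σ j₀) ⟧ ℚ.+ Σℚ (λ j → c (punchIn j₀ j) ℚ.* ⟦ δ (σ j₀) (σ (punchIn j₀ j)) ⟧)
    ≡⟨ cong₂ (λ z S → c j₀ ℚ.* ⟦ z ⟧ ℚ.+ S) (δ-diagonal (σ j₀))
         (Σℚ-δ-missed (c ∘ punchIn j₀) (σ ∘ punchIn j₀) (λ j eq → Fin.punchInᵢ≢i j₀ j (σ-injective eq))) ⟩
  c j₀ ℚ.* 1ℚ ℚ.+ 0ℚ
    ≡⟨ trans (ℚ.+-identityʳ _) (ℚ.*-identityʳ (c j₀)) ⟩
  c j₀ ∎
  where open ≡-Reasoning

inverse : ∀ q → q ≢ 0ℚ → ∃ λ r → r ℚ.* q ≡ 1ℚ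
inverse q q≢0 = (ℚ.1/ q) {{ℚ.≢-nonZero q≢0}} , ℚ.*-inverseˡ q {{ℚ.≢-nonZero q≢0}}

⟦⟧≢0 : ∀ {a} → a ≢ 0ℤ → ⟦ a ⟧ ≢ 0ℚ
⟦⟧≢0 {a} a≢0 eq = a≢0 (⟦⟧≡0 a eq)

~0-unscale : ∀ q {s} → q ≢ 0ℚ → (λ n → q ℚ.* s n) ~0 → s ~0
~0-unscale q {s} q≢0 qs~0 = ~0-cong (λ n → begin
  r ℚ.* (q ℚ.* s n)  ≡⟨ ℚ.*-assoc r q (s n) ⟨
  r ℚ.* q ℚ.* s n    ≡⟨ cong (ℚ._* s n) rq≡1 ⟩
  1ℚ ℚ.* s n         ≡⟨ ℚ.*-identityˡ (s n) ⟩
  s n                ∎) (~0-scale r qs~0)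
  where
  open ≡-Reasoning
  r = proj₁ (inverse q q≢0)
  rq≡1 = proj₂ (inverse q q≢0)

module Completion {m} {v : Vector ℤ (suc m)} (U : UnimodularCompletion v) where

  open UnimodularCompletion U renaming
    (content to g; direction to b; height to h; lift to L; generator to G) public

  direction≢0 : (∀ i → v i ≢ 0ℤ) → ∀ i → b i ≢ 0ℤ
  direction≢0 v≢0 i bᵢ≡0 = v≢0 i (trans (v≡ i) (trans (cong (g ℤ.*_) bᵢ≡0) (ℤ.*-zeroʳ g)))

  content≢0 : (∀ i → v i ≢ 0ℤ) → g ≢ 0ℤ
  content≢0 v≢0 g≡0 = v≢0 zero (trans (v≡ zero) (trans (cong (ℤ._* b zero) g≡0) (ℤ.*-zeroˡ (b zero))))

  resolution-ℚ : ∀ i j →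
    ⟦ b i ⟧ ℚ.* ⟦ h j ⟧ ℚ.+ Σℚ (λ l → ⟦ L l i ⟧ ℚ.* ⟦ G j l ⟧) ≡ ⟦ δ i j ⟧
  resolution-ℚ i j = begin
    ⟦ b i ⟧ ℚ.* ⟦ h j ⟧ ℚ.+ Σℚ (λ l → ⟦ L l i ⟧ ℚ.* ⟦ G j l ⟧)
      ≡⟨ cong₂ ℚ._+_ (⟦⟧-* (b i) (h j)) (⟦⟧-Σ* (λ l → L l i) (G j)) ⟨
    ⟦ b i ℤ.* h j ⟧ ℚ.+ ⟦ Σℤ (λ l → L l i ℤ.* G j l) ⟧
      ≡⟨ ⟦⟧-+ (b i ℤ.* h j) _ ⟨
    ⟦ b i ℤ.* h j ℤ.+ Σℤ (λ l → L l i ℤ.* G j l) ⟧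
      ≡⟨ cong ⟦_⟧ (resolution i j) ⟩
    ⟦ δ i j ⟧ ∎
    where open ≡-Reasoning

  -- This is T⁻¹T applied to the vector that carries `c j` at place `σ j`: the heights give its
  -- coordinate along `b`, and the lift restores the rest from its image under the generators. A
  -- general `σ` serves subfamilies as well as the whole family.
  reconstruct : ∀ {k} (c : Vector ℚ k) (σ : Fin k → Fin (suc m)) i →
    Σℚ (λ j → c j ℚ.* ⟦ δ i (σ j) ⟧) ≡
    ⟦ b i ⟧ ℚ.* Σℚ (λ j → c j ℚ.* ⟦ h (σ j) ⟧) ℚ.+
      Σℚ (λ l → ⟦ L l i ⟧ ℚ.* Σℚ (λ j → c j ℚ.* ⟦ G (σ j) l ⟧))
  reconstruct c σ i = begin
    Σℚ (λ j → c j ℚ.* ⟦ δ i (σ j) ⟧)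
      ≡⟨ ℚΣ.sum-cong-≗ (λ j → expand j) ⟩
    Σℚ (λ j → ⟦ b i ⟧ ℚ.* (c j ℚ.* ⟦ h (σ j) ⟧) ℚ.+ Σℚ (λ l → ⟦ L l i ⟧ ℚ.* (c j ℚ.* ⟦ G (σ j) l ⟧)))
      ≡⟨ ℚΣ.∑-distrib-+ (λ j → ⟦ b i ⟧ ℚ.* (c j ℚ.* ⟦ h (σ j) ⟧))
           (λ j → Σℚ (λ l → ⟦ L l i ⟧ ℚ.* (c j ℚ.* ⟦ G (σ j) l ⟧))) ⟩
    Σℚ (λ j → ⟦ b i ⟧ ℚ.* (c j ℚ.* ⟦ h (σ j) ⟧)) ℚ.+
      Σℚ (λ j → Σℚ (λ l → ⟦ L l i ⟧ ℚ.* (c j ℚ.* ⟦ G (σ j) l ⟧)))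
      ≡⟨ cong₂ ℚ._+_ (sym (ℚΣ.*-distribˡ-sum ⟦ b i ⟧ (λ j → c j ℚ.* ⟦ h (σ j) ⟧)))
           (trans (ℚΣ.∑-comm (λ j l → ⟦ L l i ⟧ ℚ.* (c j ℚ.* ⟦ G (σ j) l ⟧)))
             (ℚΣ.sum-cong-≗ (λ l → sym (ℚΣ.*-distribˡ-sum ⟦ L l i ⟧ (λ j → c j ℚ.* ⟦ G (σ j) l ⟧))))) ⟩
    ⟦ b i ⟧ ℚ.* Σℚ (λ j → c j ℚ.* ⟦ h (σ j) ⟧) ℚ.+
      Σℚ (λ l → ⟦ L l i ⟧ ℚ.* Σℚ (λ j → c j ℚ.* ⟦ G (σ j) l ⟧)) ∎
    where
    open ≡-Reasoning
    commute : ∀ a b c → a ℚ.* (b ℚ.* c) ≡ b ℚ.* (a ℚ.* c)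
    commute = solve-∀ ℚ-ring
    expand : ∀ j → c j ℚ.* ⟦ δ i (σ j) ⟧ ≡
      ⟦ b i ⟧ ℚ.* (c j ℚ.* ⟦ h (σ j) ⟧) ℚ.+ Σℚ (λ l → ⟦ L l i ⟧ ℚ.* (c j ℚ.* ⟦ G (σ j) l ⟧))
    expand j = begin
      c j ℚ.* ⟦ δ i (σ j) ⟧
        ≡⟨ cong (c j ℚ.*_) (resolution-ℚ i (σ j)) ⟨
      c j ℚ.* (⟦ b i ⟧ ℚ.* ⟦ h (σ j) ⟧ ℚ.+ Σℚ (λ l → ⟦ L l i ⟧ ℚ.* ⟦ G (σ j) l ⟧))
        ≡⟨ ℚ.*-distribˡ-+ (c j) _ _ ⟩
      c j ℚ.* (⟦ b i ⟧ ℚ.* ⟦ h (σ j) ⟧) ℚ.+ c j ℚ.* Σℚ (λ l → ⟦ L l i ⟧ ℚ.* ⟦ G (σ j) l ⟧)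
        ≡⟨ cong₂ ℚ._+_ (commute (c j) ⟦ b i ⟧ ⟦ h (σ j) ⟧)
             (trans (ℚΣ.*-distribˡ-sum (c j) (λ l → ⟦ L l i ⟧ ℚ.* ⟦ G (σ j) l ⟧))
               (ℚΣ.sum-cong-≗ (λ l → commute (c j) ⟦ L l i ⟧ ⟦ G (σ j) l ⟧))) ⟩
      ⟦ b i ⟧ ℚ.* (c j ℚ.* ⟦ h (σ j) ⟧) ℚ.+ Σℚ (λ l → ⟦ L l i ⟧ ℚ.* (c j ℚ.* ⟦ G (σ j) l ⟧)) ∎

  -- A vanishing combination leaves, by `reconstruct`, only a multiple μ b of the direction. The
  -- index `j` missed by `σ` has coefficient 0 while `b j` is nonzero, so μ vanishes, and with it
  -- every coefficient.
  generators-in-general-position : (∀ i → v i ≢ 0ℤ) → LinearGeneralPosition (ι ∘ G)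
  generators-in-general-position v≢0 σ σ-injective c relation k₀ =
    ~0⇒≈ {c k₀} {0ℝ} (~0-cong coefficient (~0-+ (~0-scale ⟦ b (σ k₀) ⟧ μ~0) (lifted (σ k₀))))
    where
    open ≡-Reasoning
    C : ℕ → Vector ℚ _
    C n k = seq (c k) n
    μ : ℕ → ℚ
    μ n = Σℚ (λ k → C n k ℚ.* ⟦ h (σ k) ⟧)
    E : Fin m → ℕ → ℚ
    E l n = Σℚ (λ k → C n k ℚ.* ⟦ G (σ k) l ⟧)
    E~0 : ∀ l → E l ~0
    E~0 l = ~0-cong (λ n → trans (ℚ.+-identityʳ _) (seq-sum (λ k → c k * fromℤ (G (σ k) l)) n))
      (≈⇒~0 {∑ (λ k → c k • ι (G (σ k))) l} {0ℝ} (relation l))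
    lifted : ∀ i → (λ n → Σℚ (λ l → ⟦ L l i ⟧ ℚ.* E l n)) ~0
    lifted i = ~0-Σ (λ l → ~0-scale ⟦ L l i ⟧ (E~0 l))
    j = proj₁ (missed-index σ)
    j∉σ = proj₂ (missed-index σ)
    solve-for : ∀ {a b} → 0ℚ ≡ a ℚ.+ b → ℚ.- b ≡ a
    solve-for {a} {b} eq = begin
      ℚ.- b              ≡⟨ ℚ.+-identityˡ (ℚ.- b) ⟨
      0ℚ ℚ.+ ℚ.- b       ≡⟨ cong (ℚ._+ ℚ.- b) eq ⟩
      a ℚ.+ b ℚ.+ ℚ.- b  ≡⟨ cancel a b ⟩
      a                  ∎
      where
      cancel : ∀ a b → a ℚ.+ b ℚ.+ ℚ.- b ≡ a
      cancel = solve-∀ ℚ-ring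
    μ~0 : μ ~0
    μ~0 = ~0-unscale ⟦ b j ⟧ (⟦⟧≢0 (direction≢0 v≢0 j)) $
      ~0-cong (λ n → solve-for (trans (sym (Σℚ-δ-missed (C n) σ j∉σ)) (reconstruct (C n) σ j)))
        (~0-neg (lifted j))
    coefficient : ∀ n → ⟦ b (σ k₀) ⟧ ℚ.* μ n ℚ.+ Σℚ (λ l → ⟦ L l (σ k₀) ⟧ ℚ.* E l n) ≡ C n k₀ ℚ.- 0ℚ
    coefficient n = trans (sym (reconstruct (C n) σ (σ k₀)))
      (trans (Σℚ-δ-hit (C n) σ σ-injective k₀) (sym (ℚ.+-identityʳ (C n k₀))))

-- Lonely runners from zonotopes

largest : ∀ {k} (f : Vector ℚ (suc k)) → ∃ λ i → ∀ j → f j ℚ.≤ f i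
largest f =
  let i , _ , f≤ = least U? (λ i j → f j ℚ.≤ f i) (λ i j → ℚ.≤-total (f j) (f i))
                     (λ p q → ℚ.≤-trans q p) (zero , tt)
  in i , λ j → f≤ j tt

-- All intervals contain `μ` asymptotically, so every lower end is at most every upper end, and the
-- largest lower end lies in all of them. This replaces a real time by a rational one.
common-point : ∀ {k} (l u : Vector ℚ (suc k)) (μ : ℕ → ℚ) →
  (∀ i → (λ n → l i ℚ.- μ n) ≲0) → (∀ i → (λ n → μ n ℚ.- u i) ≲0) →
  ∃ λ x → ∀ i → l i ℚ.≤ x × x ℚ.≤ u i
common-point l u μ l≲μ μ≲u =
  let i , l≤ = largest l
  in l i , λ j → l≤ j , 0≤diff⁻¹ (below i j)
  where
  swap : ∀ l u → ℚ.- (l ℚ.- u) ≡ u ℚ.- l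
  swap = solve-∀ ℚ-ring
  telescope : ∀ l μ u → (l ℚ.- μ) ℚ.+ (μ ℚ.- u) ≡ l ℚ.- u
  telescope = solve-∀ ℚ-ring
  below : ∀ i j → 0ℚ ℚ.≤ u j ℚ.- l i
  below i j = subst (0ℚ ℚ.≤_) (swap (l i) (u j)) $ 0≤-neg $ ≲0-const⁻¹ $
    ≲0-cong (λ n → telescope (l i) (μ n) (u j)) (≲0-+ (l≲μ i) (μ≲u j))

-- The interval is pulled back from [lo, hi] along x ↦ b x + z. The record hides the sign of `b`,
-- which decides which end comes from `lo`.
record AffineInterval (b z lo hi : ℚ) (μ : ℕ → ℚ) : Set where
  field
    lower upper : ℚ
    lower≲μ : (λ n → lower ℚ.- μ n) ≲0
    μ≲upper : (λ n → μ n ℚ.- upper) ≲0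
    inside  : ∀ x → lower ℚ.≤ x → x ℚ.≤ upper → lo ℚ.≤ b ℚ.* x ℚ.+ z × b ℚ.* x ℚ.+ z ℚ.≤ hi

-- `r` equals the square of `r` times `b`.
1/-nonneg : ∀ b r → 0ℚ ℚ.≤ b → r ℚ.* b ≡ 1ℚ → 0ℚ ℚ.≤ r
1/-nonneg b r 0≤b rb≡1 = subst (0ℚ ℚ.≤_) rrb≡r (0≤-* (square r) 0≤b)
  where
  square : ∀ r → 0ℚ ℚ.≤ r ℚ.* r
  square r with ℚ.≤-total 0ℚ r
  ... | inj₁ 0≤r = 0≤-* 0≤r 0≤r
  ... | inj₂ r≤0 = subst (0ℚ ℚ.≤_) (neg*neg r) (0≤-* (0≤-neg r≤0) (0≤-neg r≤0))
    where
    neg*neg : ∀ r → ℚ.- r ℚ.* ℚ.- r ≡ r ℚ.* r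
    neg*neg = solve-∀ ℚ-ring
  rrb≡r : r ℚ.* r ℚ.* b ≡ r
  rrb≡r = trans (ℚ.*-assoc r r b) (trans (cong (r ℚ.*_) rb≡1) (ℚ.*-identityʳ r))

affine-interval : ∀ b z lo hi μ → b ≢ 0ℚ →
  (λ n → lo ℚ.- (b ℚ.* μ n ℚ.+ z)) ≲0 → (λ n → (b ℚ.* μ n ℚ.+ z) ℚ.- hi) ≲0 →
  AffineInterval b z lo hi μ
affine-interval b z lo hi μ b≢0 lo≲ ≲hi = interval (ℚ.≤-total 0ℚ b)
  where
  open ≡-Reasoning
  r = proj₁ (inverse b b≢0)
  rb≡1 = proj₂ (inverse b b≢0)
  regroup₁ : ∀ r b z c m → r ℚ.* (c ℚ.- (b ℚ.* m ℚ.+ z)) ≡ r ℚ.* (c ℚ.- z) ℚ.- r ℚ.* b ℚ.* m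
  regroup₁ = solve-∀ ℚ-ring
  regroup₂ : ∀ r b z c m → r ℚ.* ((b ℚ.* m ℚ.+ z) ℚ.- c) ≡ r ℚ.* b ℚ.* m ℚ.- r ℚ.* (c ℚ.- z)
  regroup₂ = solve-∀ ℚ-ring
  regroup₃ : ∀ r b z c m → b ℚ.* (m ℚ.- r ℚ.* (c ℚ.- z)) ≡ (b ℚ.* m ℚ.+ z) ℚ.- (r ℚ.* b ℚ.* (c ℚ.- z) ℚ.+ z)
  regroup₃ = solve-∀ ℚ-ring
  regroup₄ : ∀ r b z c m → b ℚ.* (r ℚ.* (c ℚ.- z) ℚ.- m) ≡ (r ℚ.* b ℚ.* (c ℚ.- z) ℚ.+ z) ℚ.- (b ℚ.* m ℚ.+ z)
  regroup₄ = solve-∀ ℚ-ring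
  flip : ∀ r x y → ℚ.- r ℚ.* (x ℚ.- y) ≡ r ℚ.* (y ℚ.- x)
  flip = solve-∀ ℚ-ring
  restore : ∀ c z → 1ℚ ℚ.* (c ℚ.- z) ℚ.+ z ≡ c
  restore = solve-∀ ℚ-ring
  point : ℚ → ℚ
  point c = r ℚ.* (c ℚ.- z)
  below : ∀ c m → r ℚ.* (c ℚ.- (b ℚ.* m ℚ.+ z)) ≡ point c ℚ.- m
  below c m = trans (regroup₁ r b z c m)
    (cong (λ u → point c ℚ.- u) (trans (cong (ℚ._* m) rb≡1) (ℚ.*-identityˡ m)))
  above : ∀ c m → r ℚ.* ((b ℚ.* m ℚ.+ z) ℚ.- c) ≡ m ℚ.- point c
  above c m = trans (regroup₂ r b z c m)
    (cong (ℚ._- point c) (trans (cong (ℚ._* m) rb≡1) (ℚ.*-identityˡ m)))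
  back : ∀ c → r ℚ.* b ℚ.* (c ℚ.- z) ℚ.+ z ≡ c
  back c = trans (cong (λ u → u ℚ.* (c ℚ.- z) ℚ.+ z) rb≡1) (restore c z)
  from-point : ∀ c m → b ℚ.* (m ℚ.- point c) ≡ (b ℚ.* m ℚ.+ z) ℚ.- c
  from-point c m = trans (regroup₃ r b z c m) (cong (λ u → (b ℚ.* m ℚ.+ z) ℚ.- u) (back c))
  to-point : ∀ c m → b ℚ.* (point c ℚ.- m) ≡ c ℚ.- (b ℚ.* m ℚ.+ z)
  to-point c m = trans (regroup₄ r b z c m) (cong (ℚ._- (b ℚ.* m ℚ.+ z)) (back c))
  interval : 0ℚ ℚ.≤ b ⊎ b ℚ.≤ 0ℚ → AffineInterval b z lo hi μ
  interval (inj₁ 0≤b) = record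
    { lower   = point lo
    ; upper   = point hi
    ; lower≲μ = ≲0-cong (λ n → below lo (μ n)) (≲0-scale 0≤r lo≲)
    ; μ≲upper = ≲0-cong (λ n → above hi (μ n)) (≲0-scale 0≤r ≲hi)
    ; inside  = λ x l≤x x≤u →
        0≤diff⁻¹ (subst (0ℚ ℚ.≤_) (from-point lo x) (0≤-* 0≤b (0≤diff l≤x))) ,
        0≤diff⁻¹ (subst (0ℚ ℚ.≤_) (to-point hi x) (0≤-* 0≤b (0≤diff x≤u)))
    }
    where 0≤r = 1/-nonneg b r 0≤b rb≡1
  interval (inj₂ b≤0) = record
    { lower   = point hi
    ; upper   = point lo
    ; lower≲μ = ≲0-cong (λ n → trans (flip r (b ℚ.* μ n ℚ.+ z) hi) (below hi (μ n))) (≲0-scale 0≤-r ≲hi)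
    ; μ≲upper = ≲0-cong (λ n → trans (flip r lo (b ℚ.* μ n ℚ.+ z)) (above lo (μ n))) (≲0-scale 0≤-r lo≲)
    ; inside  = λ x l≤x x≤u →
        0≤diff⁻¹ (subst (0ℚ ℚ.≤_) (trans (flip b (point lo) x) (from-point lo x)) (0≤-* (0≤-neg b≤0) (0≤diff x≤u))) ,
        0≤diff⁻¹ (subst (0ℚ ℚ.≤_) (trans (flip b x (point hi)) (to-point hi x)) (0≤-* (0≤-neg b≤0) (0≤diff l≤x)))
    }
    where
    neg*neg : ∀ r b → ℚ.- r ℚ.* ℚ.- b ≡ r ℚ.* b
    neg*neg = solve-∀ ℚ-ring
    0≤-r = 1/-nonneg (ℚ.- b) (ℚ.- r) (0≤-neg b≤0) (trans (neg*neg r b) rb≡1)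

-- The distance of `x` to ℤ is at least `ρ`. The integer `shift` is kept as data, since the shifts
-- of all runners later enter the lattice vector to be hit.
record AwayFromIntegers (ρ x : ℚ) : Set where
  constructor away
  field
    shift : ℤ
    ρ≤    : ρ ℚ.≤ x ℚ.+ ⟦ shift ⟧
    ≤1-ρ  : x ℚ.+ ⟦ shift ⟧ ℚ.≤ 1ℚ ℚ.- ρ

-- Contracting [0, 1] about ½ by this factor yields [ρ, 1 - ρ] with ρ = 1/(m+2). The factor of
-- Conjecture B for m+1 thus turns into the distance that m+1 runners keep from ℤ.
shrink-factor : ∀ m → + m ℚ./ suc (suc m) ≡ 1ℚ ℚ.- (1/suc (suc m) ℚ.+ 1/suc (suc m))
shrink-factor m = begin
  + m ℚ./ suc (suc m)                    ≡⟨ /-as-* (+ m) (suc m) ⟩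
  ⟦ + m ⟧ ℚ.* ρ                          ≡⟨ split ⟦ + m ⟧ ρ ⟩
  (1ℚ ℚ.+ (1ℚ ℚ.+ ⟦ + m ⟧)) ℚ.* ρ ℚ.- (ρ ℚ.+ ρ)
    ≡⟨ cong (λ q → q ℚ.* ρ ℚ.- (ρ ℚ.+ ρ)) (trans (⟦⟧-+ 1ℤ (+ suc m)) (cong (1ℚ ℚ.+_) (⟦⟧-+ 1ℤ (+ m)))) ⟨
  ⟦ + suc (suc m) ⟧ ℚ.* ρ ℚ.- (ρ ℚ.+ ρ)  ≡⟨ cong (ℚ._- (ρ ℚ.+ ρ)) (suc*1/suc (suc m)) ⟩
  1ℚ ℚ.- (ρ ℚ.+ ρ)                       ∎
  where
  open ≡-Reasoning
  ρ = 1/suc (suc m)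
  split : ∀ m ρ → m ℚ.* ρ ≡ (1ℚ ℚ.+ (1ℚ ℚ.+ m)) ℚ.* ρ ℚ.- (ρ ℚ.+ ρ)
  split = solve-∀ ℚ-ring

0≤shrink-factor : ∀ m → 0ℚ ℚ.≤ + m ℚ./ suc (suc m)
0≤shrink-factor m = ℚ.nonNegative⁻¹ (+ m ℚ./ suc (suc m)) {{ℚ.normalize-nonNeg m (suc (suc m))}}

zonotope-combination : ∀ {d m} (u : Vector (Vector ℤ d) m) (x : Vector ℝ d) →
  x ∈ MinkowskiSum (λ i → Segment 𝟎 (ι (u i))) →
  ∃ λ (t : Vector ℝ m) → (∀ i → 0ℝ ≤ t i × t i ≤ 1ℝ) ×
    (∀ l → (λ n → Σℚ (λ i → seq (t i) n ℚ.* ⟦ u i l ⟧) ℚ.- seq (x l) n) ~0)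
zonotope-combination {m = m} u x (q , q∈ , x≋∑q) = t , (λ i → proj₁ (proj₂ (q∈ i)) , proj₁ (proj₂ (proj₂ (q∈ i)))) ,
  λ l → ~0-cong
    (λ n → trans (cong₂ ℚ._+_ (summands l n)
             (trans (swap (seq (x l) n) (seq (∑ q l) n)) (cong (ℚ._- seq (x l) n) (seq-sum (λ i → q i l) n))))
             (telescope (Σℚ (λ i → seq (t i) n ℚ.* ⟦ u i l ⟧)) (Σℚ (λ i → seq (q i l) n)) (seq (x l) n)))
    (~0-+ (~0-Σ (λ i → ~0-neg (≈⇒~0 {q i l} {(1ℝ - t i) * 0ℝ + t i * fromℤ (u i l)} (proj₂ (proj₂ (proj₂ (q∈ i))) l))))
          (~0-neg (≈⇒~0 {x l} {∑ q l} (x≋∑q l))))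
  where
  open ≡-Reasoning
  t : Vector ℝ m
  t i = proj₁ (q∈ i)
  swap : ∀ a b → ℚ.- (a ℚ.- b) ≡ b ℚ.- a
  swap = solve-∀ ℚ-ring
  telescope : ∀ a b c → (a ℚ.- b) ℚ.+ (b ℚ.- c) ≡ a ℚ.- c
  telescope = solve-∀ ℚ-ring
  rearrange : ∀ q t g → ℚ.- (q ℚ.- ((1ℚ ℚ.- t) ℚ.* 0ℚ ℚ.+ t ℚ.* g)) ≡ t ℚ.* g ℚ.+ (ℚ.- 1ℚ) ℚ.* q
  rearrange = solve-∀ ℚ-ring
  negate : ∀ q → (ℚ.- 1ℚ) ℚ.* q ≡ ℚ.- q
  negate = solve-∀ ℚ-ring
  summands : ∀ l n →
    Σℚ (λ i → ℚ.- (seq (q i l) n ℚ.- ((1ℚ ℚ.- seq (t i) n) ℚ.* 0ℚ ℚ.+ seq (t i) n ℚ.* ⟦ u i l ⟧))) ≡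
    Σℚ (λ i → seq (t i) n ℚ.* ⟦ u i l ⟧) ℚ.- Σℚ (λ i → seq (q i l) n)
  summands l n = begin
    Σℚ (λ i → ℚ.- (Q i ℚ.- ((1ℚ ℚ.- T i) ℚ.* 0ℚ ℚ.+ T i ℚ.* ⟦ u i l ⟧)))
      ≡⟨ ℚΣ.sum-cong-≗ (λ i → rearrange (Q i) (T i) (⟦ u i l ⟧)) ⟩
    Σℚ (λ i → T i ℚ.* ⟦ u i l ⟧ ℚ.+ (ℚ.- 1ℚ) ℚ.* Q i)
      ≡⟨ ℚΣ.∑-distrib-+ (λ i → T i ℚ.* ⟦ u i l ⟧) (λ i → (ℚ.- 1ℚ) ℚ.* Q i) ⟩
    Tu ℚ.+ Σℚ (λ i → (ℚ.- 1ℚ) ℚ.* Q i)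
      ≡⟨ cong (Tu ℚ.+_) (ℚΣ.*-distribˡ-sum (ℚ.- 1ℚ) Q) ⟨
    Tu ℚ.+ (ℚ.- 1ℚ) ℚ.* Σℚ Q
      ≡⟨ cong (Tu ℚ.+_) (negate (Σℚ Q)) ⟩
    Tu ℚ.- Σℚ Q ∎
    where
    Q T : Fin m → ℚ
    Q i = seq (q i l) n
    T i = seq (t i) n
    Tu = Σℚ (λ i → T i ℚ.* ⟦ u i l ⟧)

module Lonely {m} {v : Vector ℤ (suc m)} (v≢0 : ∀ i → v i ≢ 0ℤ) (conjecture : ConjectureB (suc m)) where

  open Completion (unimodularCompletion v)

  Z : LonelyRunnerZonotope (suc m)
  Z = record { generators = G ; generalPosition = generators-in-general-position v≢0 }

  ρ r : ℚ
  ρ = 1/suc (suc m)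
  r = + m ℚ./ suc (suc m)

  -- A point r (U t - x) of the coset x + ℤ^m, with x half the sum of the generators, makes the
  -- combination with coefficients r (t - ½) - ½ integral. These coefficients range over [ρ, 1 - ρ]
  -- moved by -1.
  lo hi : ℚ
  lo = ρ ℚ.- 1ℚ
  hi = ℚ.- ρ

  record CosetPoint : Set where
    field
      C      : ℕ → Vector ℚ (suc m)
      k      : Vector ℤ m
      combination : ∀ l → (λ n → Σℚ (λ i → C n i ℚ.* ⟦ G i l ⟧) ℚ.- ⟦ k l ⟧) ~0
      lo≲C : ∀ i → (λ n → lo ℚ.- C n i) ≲0
      C≲hi : ∀ i → (λ n → C n i ℚ.- hi) ≲0

  cosetPoint : CosetPoint
  cosetPoint with conjecture Z
  ... | p , (x , x∈Z , p≋scaled) , (k , p≋coset) = record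
    { C = C ; k = k ; combination = combination ; lo≲C = lo≲C ; C≲hi = C≲hi }
    where
    open ≡-Reasoning
    t : Vector ℝ (suc m)
    t = proj₁ (zonotope-combination G x x∈Z)
    t∈ = proj₁ (proj₂ (zonotope-combination G x x∈Z))
    T : ℕ → Vector ℚ (suc m)
    T n i = seq (t i) n
    C : ℕ → Vector ℚ (suc m)
    C n i = r ℚ.* (T n i ℚ.- ½) ℚ.- ½
    lo-gap : ∀ ρ t → (1ℚ ℚ.- (ρ ℚ.+ ρ)) ℚ.* (0ℚ ℚ.- t) ≡
      (ρ ℚ.- 1ℚ) ℚ.- ((1ℚ ℚ.- (ρ ℚ.+ ρ)) ℚ.* (t ℚ.- ½) ℚ.- ½)
    lo-gap = solve-∀ ℚ-ring
    hi-gap : ∀ ρ t → (1ℚ ℚ.- (ρ ℚ.+ ρ)) ℚ.* (t ℚ.- 1ℚ) ≡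
      ((1ℚ ℚ.- (ρ ℚ.+ ρ)) ℚ.* (t ℚ.- ½) ℚ.- ½) ℚ.- (ℚ.- ρ)
    hi-gap = solve-∀ ℚ-ring
    lo≲C : ∀ i → (λ n → lo ℚ.- C n i) ≲0
    lo≲C i = ≲0-cong
      (λ n → subst (λ r → r ℚ.* (0ℚ ℚ.- T n i) ≡ lo ℚ.- (r ℚ.* (T n i ℚ.- ½) ℚ.- ½))
               (sym (shrink-factor m)) (lo-gap ρ (T n i)))
      (≲0-scale (0≤shrink-factor m) (≤⇒≲0 {0ℝ} {t i} (proj₁ (t∈ i))))
    C≲hi : ∀ i → (λ n → C n i ℚ.- hi) ≲0
    C≲hi i = ≲0-cong
      (λ n → subst (λ r → r ℚ.* (T n i ℚ.- 1ℚ) ≡ (r ℚ.* (T n i ℚ.- ½) ℚ.- ½) ℚ.- hi)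
               (sym (shrink-factor m)) (hi-gap ρ (T n i)))
      (≲0-scale (0≤shrink-factor m) (≤⇒≲0 {t i} {1ℝ} (proj₂ (t∈ i))))
    module _ (l : Fin m) where
      X : ℚ
      X = Σℚ (λ i → ⟦ G i l ⟧)
      TG : ℕ → ℚ
      TG n = Σℚ (λ i → T n i ℚ.* ⟦ G i l ⟧)
      TG-x : (λ n → TG n ℚ.- seq (x l) n) ~0
      TG-x = proj₂ (proj₂ (zonotope-combination G x x∈Z)) l
      center≡ : ∀ n → seq (fromℚ ½ * ∑ (ι ∘ G) l) n ≡ ½ ℚ.* X
      center≡ n = cong (½ ℚ.*_) (seq-sum (λ i → fromℤ (G i l)) n)
      scaled : (λ n → seq (p l) n ℚ.- r ℚ.* (seq (x l) n ℚ.- ½ ℚ.* X)) ~0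
      scaled = ~0-cong
        (λ n → cong (λ c → seq (p l) n ℚ.- r ℚ.* (seq (x l) n ℚ.- c)) (center≡ n))
        (≈⇒~0 {p l} {fromℚ r * (x l - fromℚ ½ * ∑ (ι ∘ G) l)} (p≋scaled l))
      coset : (λ n → seq (p l) n ℚ.- (½ ℚ.* X ℚ.+ ⟦ k l ⟧)) ~0
      coset = ~0-cong
        (λ n → cong (λ x → seq (p l) n ℚ.- (x ℚ.+ ⟦ k l ⟧)) (center≡ n))
        (≈⇒~0 {p l} {fromℚ ½ * ∑ (ι ∘ G) l + fromℤ (k l)} (p≋coset l))
      expand : ∀ n → Σℚ (λ i → C n i ℚ.* ⟦ G i l ⟧) ≡ r ℚ.* TG n ℚ.+ (ℚ.- (r ℚ.* ½) ℚ.- ½) ℚ.* X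
      expand n = begin
        Σℚ (λ i → C n i ℚ.* ⟦ G i l ⟧)
          ≡⟨ ℚΣ.sum-cong-≗ (λ i → split r (T n i) (⟦ G i l ⟧)) ⟩
        Σℚ (λ i → r ℚ.* (T n i ℚ.* ⟦ G i l ⟧) ℚ.+ (ℚ.- (r ℚ.* ½) ℚ.- ½) ℚ.* ⟦ G i l ⟧)
          ≡⟨ ℚΣ.∑-distrib-+ (λ i → r ℚ.* (T n i ℚ.* ⟦ G i l ⟧)) (λ i → (ℚ.- (r ℚ.* ½) ℚ.- ½) ℚ.* ⟦ G i l ⟧) ⟩
        Σℚ (λ i → r ℚ.* (T n i ℚ.* ⟦ G i l ⟧)) ℚ.+ Σℚ (λ i → (ℚ.- (r ℚ.* ½) ℚ.- ½) ℚ.* ⟦ G i l ⟧)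
          ≡⟨ cong₂ ℚ._+_ (ℚΣ.*-distribˡ-sum r (λ i → T n i ℚ.* ⟦ G i l ⟧))
               (ℚΣ.*-distribˡ-sum (ℚ.- (r ℚ.* ½) ℚ.- ½) (λ i → ⟦ G i l ⟧)) ⟨
        r ℚ.* TG n ℚ.+ (ℚ.- (r ℚ.* ½) ℚ.- ½) ℚ.* X ∎
        where
        split : ∀ r t g → (r ℚ.* (t ℚ.- ½) ℚ.- ½) ℚ.* g ≡ r ℚ.* (t ℚ.* g) ℚ.+ (ℚ.- (r ℚ.* ½) ℚ.- ½) ℚ.* g
        split = solve-∀ ℚ-ring
      combination : (λ n → Σℚ (λ i → C n i ℚ.* ⟦ G i l ⟧) ℚ.- ⟦ k l ⟧) ~0
      combination = ~0-cong
        (λ n → trans (telescope r (TG n) (seq (x l) n) (seq (p l) n) X (⟦ k l ⟧))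
                 (cong (ℚ._- ⟦ k l ⟧) (sym (expand n))))
        (~0-+ (~0-scale r TG-x) (~0-+ (~0-neg scaled) coset))
        where
        telescope : ∀ r t z p x k →
          r ℚ.* (t ℚ.- z) ℚ.+
            (ℚ.- (p ℚ.- r ℚ.* (z ℚ.- ½ ℚ.* x)) ℚ.+ (p ℚ.- (½ ℚ.* x ℚ.+ k))) ≡
          (r ℚ.* t ℚ.+ (ℚ.- (r ℚ.* ½) ℚ.- ½) ℚ.* x) ℚ.- k
        telescope = solve-∀ ℚ-ring

  open CosetPoint cosetPoint

  μ : ℕ → ℚ
  μ n = Σℚ (λ j → C n j ℚ.* ⟦ h j ⟧)

  E : Fin m → ℕ → ℚ
  E l n = Σℚ (λ j → C n j ℚ.* ⟦ G j l ⟧) ℚ.- ⟦ k l ⟧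

  z : Vector ℤ (suc m)
  z i = Σℤ (λ l → L l i ℤ.* k l)

  -- `reconstruct` splits `C` into μ b and the lift of its image under the generators. That image
  -- tends to the integer vector `k`, whose lift is the integer vector `z`.
  approach : ∀ i → (λ n → C n i ℚ.- (⟦ b i ⟧ ℚ.* μ n ℚ.+ ⟦ z i ⟧)) ~0
  approach i = ~0-cong difference (~0-Σ (λ l → ~0-scale ⟦ L l i ⟧ (combination l)))
    where
    open ≡-Reasoning
    rearrange : ∀ a s k → a ℚ.* (s ℚ.- k) ≡ a ℚ.* s ℚ.+ (ℚ.- 1ℚ) ℚ.* (a ℚ.* k)
    rearrange = solve-∀ ℚ-ring
    cancel : ∀ bμ s z → s ℚ.+ (ℚ.- 1ℚ) ℚ.* z ≡ (bμ ℚ.+ s) ℚ.- (bμ ℚ.+ z)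
    cancel = solve-∀ ℚ-ring
    difference : ∀ n → Σℚ (λ l → ⟦ L l i ⟧ ℚ.* E l n) ≡ C n i ℚ.- (⟦ b i ⟧ ℚ.* μ n ℚ.+ ⟦ z i ⟧)
    difference n = begin
      Σℚ (λ l → ⟦ L l i ⟧ ℚ.* E l n)
        ≡⟨ ℚΣ.sum-cong-≗ (λ l → rearrange ⟦ L l i ⟧ (S l) ⟦ k l ⟧) ⟩
      Σℚ (λ l → ⟦ L l i ⟧ ℚ.* S l ℚ.+ (ℚ.- 1ℚ) ℚ.* (⟦ L l i ⟧ ℚ.* ⟦ k l ⟧))
        ≡⟨ ℚΣ.∑-distrib-+ (λ l → ⟦ L l i ⟧ ℚ.* S l) (λ l → (ℚ.- 1ℚ) ℚ.* (⟦ L l i ⟧ ℚ.* ⟦ k l ⟧)) ⟩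
      LS ℚ.+ Σℚ (λ l → (ℚ.- 1ℚ) ℚ.* (⟦ L l i ⟧ ℚ.* ⟦ k l ⟧))
        ≡⟨ cong (LS ℚ.+_) (trans (cong ((ℚ.- 1ℚ) ℚ.*_) (⟦⟧-Σ* (λ l → L l i) k))
             (ℚΣ.*-distribˡ-sum (ℚ.- 1ℚ) (λ l → ⟦ L l i ⟧ ℚ.* ⟦ k l ⟧))) ⟨
      LS ℚ.+ (ℚ.- 1ℚ) ℚ.* ⟦ z i ⟧
        ≡⟨ cancel (⟦ b i ⟧ ℚ.* μ n) LS ⟦ z i ⟧ ⟩
      (⟦ b i ⟧ ℚ.* μ n ℚ.+ LS) ℚ.- (⟦ b i ⟧ ℚ.* μ n ℚ.+ ⟦ z i ⟧)
        ≡⟨ cong (ℚ._- (⟦ b i ⟧ ℚ.* μ n ℚ.+ ⟦ z i ⟧))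
             (trans (sym (reconstruct (C n) (λ j → j) i)) (Σℚ-δ-hit (C n) (λ j → j) (λ eq → eq) i)) ⟩
      C n i ℚ.- (⟦ b i ⟧ ℚ.* μ n ℚ.+ ⟦ z i ⟧) ∎
      where
      S : Fin m → ℚ
      S l = Σℚ (λ j → C n j ℚ.* ⟦ G j l ⟧)
      LS = Σℚ (λ l → ⟦ L l i ⟧ ℚ.* S l)

  interval : ∀ i → AffineInterval ⟦ b i ⟧ ⟦ z i ⟧ lo hi μ
  interval i = affine-interval ⟦ b i ⟧ ⟦ z i ⟧ lo hi μ (⟦⟧≢0 (direction≢0 v≢0 i))
    (≲0-cong (λ n → telescope lo (C n i) (⟦ b i ⟧ ℚ.* μ n ℚ.+ ⟦ z i ⟧))
      (≲0-+ (lo≲C i) (proj₁ (approach i))))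
    (≲0-cong (λ n → telescope′ (C n i) (⟦ b i ⟧ ℚ.* μ n ℚ.+ ⟦ z i ⟧) hi)
      (≲0-+ (proj₂ (approach i)) (C≲hi i)))
    where
    telescope : ∀ a c d → (a ℚ.- c) ℚ.+ (c ℚ.- d) ≡ a ℚ.- d
    telescope = solve-∀ ℚ-ring
    telescope′ : ∀ c d e → ℚ.- (c ℚ.- d) ℚ.+ (c ℚ.- e) ≡ d ℚ.- e
    telescope′ = solve-∀ ℚ-ring

  lonely : ∃ λ τ → ∀ i → AwayFromIntegers ρ (τ ℚ.* ⟦ v i ⟧)
  -- Since v = g b, the time for `v` is the time `x` for `b` divided by `g`. The added 1 undoes the
  -- move from [ρ, 1 - ρ] to [lo, hi].
  lonely = x ℚ.* g⁻¹ , λ i →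
    let l≤x , x≤u = x∈ i
        lo≤ , ≤hi = AffineInterval.inside (interval i) x l≤x x≤u
    in away (z i ℤ.+ 1ℤ)
         (0≤diff⁻¹ (subst (0ℚ ℚ.≤_) (trans (lo-shift ρ (position i)) (cong (ℚ._- ρ) (value i))) (0≤diff lo≤)))
         (0≤diff⁻¹ (subst (0ℚ ℚ.≤_) (trans (hi-shift ρ (position i)) (cong (λ u → (1ℚ ℚ.- ρ) ℚ.- u) (value i))) (0≤diff ≤hi)))
    where
    open ≡-Reasoning
    g⁻¹ = proj₁ (inverse ⟦ g ⟧ (⟦⟧≢0 (content≢0 v≢0)))
    g⁻¹g≡1 = proj₂ (inverse ⟦ g ⟧ (⟦⟧≢0 (content≢0 v≢0)))
    point = common-point (λ i → AffineInterval.lower (interval i)) (λ i → AffineInterval.upper (interval i)) μ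
      (λ i → AffineInterval.lower≲μ (interval i)) (λ i → AffineInterval.μ≲upper (interval i))
    x = proj₁ point
    x∈ = proj₂ point
    position : Fin (suc m) → ℚ
    position i = ⟦ b i ⟧ ℚ.* x ℚ.+ ⟦ z i ⟧
    lo-shift : ∀ ρ y → y ℚ.- (ρ ℚ.- 1ℚ) ≡ (y ℚ.+ 1ℚ) ℚ.- ρ
    lo-shift = solve-∀ ℚ-ring
    hi-shift : ∀ ρ y → ℚ.- ρ ℚ.- y ≡ (1ℚ ℚ.- ρ) ℚ.- (y ℚ.+ 1ℚ)
    hi-shift = solve-∀ ℚ-ring
    regroup : ∀ x g⁻¹ g b z → x ℚ.* g⁻¹ ℚ.* (g ℚ.* b) ℚ.+ (z ℚ.+ 1ℚ) ≡ g⁻¹ ℚ.* g ℚ.* (b ℚ.* x) ℚ.+ z ℚ.+ 1ℚ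
    regroup = solve-∀ ℚ-ring
    value : ∀ i → ⟦ b i ⟧ ℚ.* x ℚ.+ ⟦ z i ⟧ ℚ.+ 1ℚ ≡ x ℚ.* g⁻¹ ℚ.* ⟦ v i ⟧ ℚ.+ ⟦ z i ℤ.+ 1ℤ ⟧
    value i = sym $ begin
      x ℚ.* g⁻¹ ℚ.* ⟦ v i ⟧ ℚ.+ ⟦ z i ℤ.+ 1ℤ ⟧
        ≡⟨ cong₂ (λ a c → x ℚ.* g⁻¹ ℚ.* a ℚ.+ c) (trans (cong ⟦_⟧ (v≡ i)) (⟦⟧-* g (b i))) (⟦⟧-+ (z i) 1ℤ) ⟩
      x ℚ.* g⁻¹ ℚ.* (⟦ g ⟧ ℚ.* ⟦ b i ⟧) ℚ.+ (⟦ z i ⟧ ℚ.+ 1ℚ)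
        ≡⟨ regroup x g⁻¹ ⟦ g ⟧ ⟦ b i ⟧ ⟦ z i ⟧ ⟩
      g⁻¹ ℚ.* ⟦ g ⟧ ℚ.* (⟦ b i ⟧ ℚ.* x) ℚ.+ ⟦ z i ⟧ ℚ.+ 1ℚ
        ≡⟨ cong (λ a → a ℚ.+ ⟦ z i ⟧ ℚ.+ 1ℚ) (trans (cong (ℚ._* (⟦ b i ⟧ ℚ.* x)) g⁻¹g≡1) (ℚ.*-identityˡ (⟦ b i ⟧ ℚ.* x))) ⟩
      ⟦ b i ⟧ ℚ.* x ℚ.+ ⟦ z i ⟧ ℚ.+ 1ℚ ∎

-- Abstract, since unfolding the construction during conversion checking is very costly.
abstract
  lonely : ∀ {m} → ConjectureB (suc m) → (v : Vector ℤ (suc m)) → (∀ k → v k ≢ 0ℤ) →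
    ∃ λ τ → ∀ k → AwayFromIntegers (1/suc (suc m)) (τ ℚ.* ⟦ v k ⟧)
  lonely conjecture v v≢0 = Lonely.lonely v≢0 conjecture

-- Merging two runners

-- The shift 1 - z turns x + z into 1 - (x + z), and this reflection preserves [ρ, 1 - ρ].
away-neg : ∀ {ρ x} → AwayFromIntegers ρ x → AwayFromIntegers ρ (ℚ.- x)
away-neg {ρ} {x} (away z ρ≤ ≤1-ρ) = away (1ℤ ℤ.+ ℤ.- z)
  (0≤diff⁻¹ (subst (0ℚ ℚ.≤_) (trans (eq₁ ρ x ⟦ z ⟧) (cong (λ w → ℚ.- x ℚ.+ w ℚ.- ρ) (sym shifted))) (0≤diff ≤1-ρ)))
  (0≤diff⁻¹ (subst (0ℚ ℚ.≤_) (trans (eq₂ ρ x ⟦ z ⟧) (cong (λ w → 1ℚ ℚ.- ρ ℚ.- (ℚ.- x ℚ.+ w)) (sym shifted))) (0≤diff ρ≤)))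
  where
  shifted : ⟦ 1ℤ ℤ.+ ℤ.- z ⟧ ≡ 1ℚ ℚ.+ ℚ.- ⟦ z ⟧
  shifted = trans (⟦⟧-+ 1ℤ (ℤ.- z)) (cong (1ℚ ℚ.+_) (⟦⟧-neg z))
  eq₁ : ∀ ρ x z → 1ℚ ℚ.- ρ ℚ.- (x ℚ.+ z) ≡ ℚ.- x ℚ.+ (1ℚ ℚ.+ ℚ.- z) ℚ.- ρ
  eq₁ = solve-∀ ℚ-ring
  eq₂ : ∀ ρ x z → x ℚ.+ z ℚ.- ρ ≡ 1ℚ ℚ.- ρ ℚ.- (ℚ.- x ℚ.+ (1ℚ ℚ.+ ℚ.- z))
  eq₂ = solve-∀ ℚ-ring

unit-cases : ∀ ε → ε ℤ.* ε ≡ 1ℤ → ε ≡ 1ℤ ⊎ ε ≡ -1ℤ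
unit-cases ε ε²≡1 with ε | ℕ.m*n≡1⇒m≡1 ℤ.∣ ε ∣ ℤ.∣ ε ∣ (trans (sym (ℤ.abs-* ε ε)) (cong ℤ.∣_∣ ε²≡1))
... | + .1       | refl = inj₁ refl
... | -[1+ .0 ]  | refl = inj₂ refl

away-unit : ∀ {ρ} τ ε u {v} → ε ℤ.* ε ≡ 1ℤ → v ≡ ε ℤ.* u →
  AwayFromIntegers ρ (τ ℚ.* ⟦ u ⟧) → AwayFromIntegers ρ (τ ℚ.* ⟦ v ⟧)
away-unit {ρ} τ ε u {v} ε²≡1 v≡εu awayᵤ with unit-cases ε ε²≡1
... | inj₁ refl = subst (λ w → AwayFromIntegers ρ (τ ℚ.* ⟦ w ⟧)) (sym (trans v≡εu (ℤ.*-identityˡ u))) awayᵤ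
... | inj₂ refl = subst (AwayFromIntegers ρ) eq (away-neg awayᵤ)
  where
  eq : ℚ.- (τ ℚ.* ⟦ u ⟧) ≡ τ ℚ.* ⟦ v ⟧
  eq = trans (ℚ.neg-distribʳ-* τ ⟦ u ⟧)
    (cong (τ ℚ.*_) (trans (sym (⟦⟧-neg u)) (cong ⟦_⟧ (sym (trans v≡εu (ℤ.-1*i≡-i u))))))

-- Runners of equal or opposite speed are lonely at the same times, so one of them may be dropped.
lonely-with-equal-speeds : ∀ {m} → ConjectureB (suc m) → (v : Vector ℤ (suc (suc m))) →
  (∀ k → v k ≢ 0ℤ) → EqualSpeeds v → ∃ λ τ → ∀ k → AwayFromIntegers (1/suc (suc m)) (τ ℚ.* ⟦ v k ⟧)
lonely-with-equal-speeds {m} conjecture v v≢0 (i , j , i≢j , ε , ε²≡1 , vᵢ≡εvⱼ) =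
  τ , everyone
  where
  τ = proj₁ (lonely conjecture (v ∘ punchIn i) (v≢0 ∘ punchIn i))
  Away : Fin (suc (suc m)) → Set
  Away k = AwayFromIntegers (1/suc (suc m)) (τ ℚ.* ⟦ v k ⟧)
  others : ∀ {k} → i ≢ k → Away k
  others i≢k = subst Away (Fin.punchIn-punchOut i≢k)
    (proj₂ (lonely conjecture (v ∘ punchIn i) (v≢0 ∘ punchIn i)) (punchOut i≢k))
  everyone : ∀ k → Away k
  everyone k with i Fin.≟ k
  ... | no  i≢k  = others i≢k
  ... | yes refl = away-unit τ ε (v j) ε²≡1 vᵢ≡εvⱼ (others i≢j)

-- Integer vectors mapped into a given line by the generators

integer-independence : ∀ {d k} {u : Vector (Vector ℤ d) k} → LinearlyIndependent (ι ∘ u) →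
  ∀ c → IntegerRelation u c → ∀ i → c i ≡ 0ℤ
integer-independence {u = u} independent c relation i =
  ⟦⟧≡0 (c i) (ℚ.≤-antisym (proj₁ bounds) (proj₂ bounds))
  where
  open ≡-Reasoning
  combination : ∀ l → ∑ (λ k → fromℤ (c k) • ι (u k)) l ≈ 0ℝ
  combination l = ~0⇒≈ {∑ (λ k → fromℤ (c k) • ι (u k)) l} {0ℝ} (~0-cong (λ n → sym (vanishes n)) ~0-0)
    where
    vanishes : ∀ n → seq (∑ (λ k → fromℤ (c k) • ι (u k)) l) n ℚ.- 0ℚ ≡ 0ℚ
    vanishes n = begin
      seq (∑ (λ k → fromℤ (c k) • ι (u k)) l) n ℚ.- 0ℚ  ≡⟨ ℚ.+-identityʳ _ ⟩
      seq (∑ (λ k → fromℤ (c k) • ι (u k)) l) n         ≡⟨ seq-sum (λ k → fromℤ (c k) * fromℤ (u k l)) n ⟩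
      Σℚ (λ k → ⟦ c k ⟧ ℚ.* ⟦ u k l ⟧)                  ≡⟨ ⟦⟧-Σ* c (λ k → u k l) ⟨
      ⟦ Σℤ (λ k → c k ℤ.* u k l) ⟧                      ≡⟨ cong ⟦_⟧ (relation l) ⟩
      0ℚ                                                ∎
  cᵢ~0 : (λ _ → ⟦ c i ⟧ ℚ.- 0ℚ) ~0
  cᵢ~0 = ≈⇒~0 {fromℤ (c i)} {0ℝ} (independent (fromℤ ∘ c) combination i)
  bounds : ⟦ c i ⟧ ℚ.≤ 0ℚ × 0ℚ ℚ.≤ ⟦ c i ⟧
  bounds = subst (ℚ._≤ 0ℚ) (ℚ.+-identityʳ ⟦ c i ⟧) (≲0-const⁻¹ (proj₁ cᵢ~0)) ,
    subst (0ℚ ℚ.≤_) (flip ⟦ c i ⟧) (0≤-neg (≲0-const⁻¹ (proj₂ cᵢ~0)))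
    where
    flip : ∀ a → ℚ.- ℚ.- (a ℚ.- 0ℚ) ≡ a
    flip = solve-∀ ℚ-ring

module GeneralPosition {d} (u : Vector (Vector ℤ d) (suc d)) (generalPosition : LinearGeneralPosition (ι ∘ u)) where

  punched-relation : ∀ j c → IntegerRelation (u ∘ punchIn j) c → ∀ i → c i ≡ 0ℤ
  punched-relation j = integer-independence (generalPosition (punchIn j) (Fin.punchIn-injective j _ _))

  -- If `c j` vanished, dropping the j-th vector would leave a relation among `d` generators, which
  -- are independent; all other coefficients would vanish too.
  relation-nonzero : ∀ c → IntegerRelation u c → (∃ λ k → c k ≢ 0ℤ) → ∀ j → c j ≢ 0ℤ
  relation-nonzero c relation (k , cₖ≢0) j cⱼ≡0 with j Fin.≟ k
  ... | yes refl = cₖ≢0 cⱼ≡0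
  ... | no  j≢k  = cₖ≢0 (trans (cong c (sym (Fin.punchIn-punchOut j≢k)))
                    (punched-relation j (c ∘ punchIn j) punched (punchOut j≢k)))
    where
    open ≡-Reasoning
    punched : IntegerRelation (u ∘ punchIn j) (c ∘ punchIn j)
    punched l = begin
      S                                ≡⟨ ℤ.+-identityˡ S ⟨
      0ℤ ℤ.+ S                         ≡⟨ cong (ℤ._+ S) (trans (cong (ℤ._* u j l) cⱼ≡0) (ℤ.*-zeroˡ (u j l))) ⟨
      c j ℤ.* u j l ℤ.+ S              ≡⟨ ℤΣ.sum-remove {i = j} (λ k → c k ℤ.* u k l) ⟨
      Σℤ (λ k → c k ℤ.* u k l)         ≡⟨ relation l ⟩
      0ℤ                               ∎
      where S = Σℤ (λ k → c (punchIn j k) ℤ.* u (punchIn j k) l)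

  -- Any d+1 vectors in ℤ^d are related; here `w` takes the place of the generator `u zero`, and its
  -- coefficient is nonzero because the other generators are independent. The normalisation
  -- `a zero ≡ 0ℤ` keeps `a` from being parallel to a relation of the generators, whose entries are
  -- all nonzero.
  coordinates : (w : Vector ℤ d) → (∃ λ l → w l ≢ 0ℤ) →
    ∃₂ λ (a : Vector ℤ (suc d)) κ → a zero ≡ 0ℤ × (∃ λ k → a k ≢ 0ℤ) ×
      (∀ l → Σℤ (λ k → a k ℤ.* u k l) ≡ κ ℤ.* w l)
  coordinates w (l₀ , w≢0) = a , ℤ.- κ , refl , a≢0 , combination
    where
    open ≡-Reasoning
    u′ : Vector (Vector ℤ d) (suc d)
    u′ zero    = w
    u′ (suc k) = u (suc k)
    c = proj₁ (nontrivial-relation u′)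
    c≢0 = proj₁ (proj₂ (nontrivial-relation u′))
    relation = proj₂ (proj₂ (nontrivial-relation u′))
    κ = c zero
    a : Vector ℤ (suc d)
    a zero    = 0ℤ
    a (suc k) = c (suc k)
    S : Fin d → ℤ
    S l = Σℤ (λ k → c (suc k) ℤ.* u (suc k) l)
    isolate : ∀ x s → s ≡ (x ℤ.+ s) ℤ.+ ℤ.- x
    isolate = ℤ-solve-∀
    combination : ∀ l → Σℤ (λ k → a k ℤ.* u k l) ≡ ℤ.- κ ℤ.* w l
    combination l = begin
      0ℤ ℤ.* u zero l ℤ.+ S l                 ≡⟨ cong (ℤ._+ S l) (ℤ.*-zeroˡ (u zero l)) ⟩
      0ℤ ℤ.+ S l                              ≡⟨ ℤ.+-identityˡ (S l) ⟩
      S l                                     ≡⟨ isolate (κ ℤ.* w l) (S l) ⟩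
      (κ ℤ.* w l ℤ.+ S l) ℤ.+ ℤ.- (κ ℤ.* w l) ≡⟨ cong (ℤ._+ ℤ.- (κ ℤ.* w l)) (relation l) ⟩
      0ℤ ℤ.+ ℤ.- (κ ℤ.* w l)                  ≡⟨ ℤ.+-identityˡ (ℤ.- (κ ℤ.* w l)) ⟩
      ℤ.- (κ ℤ.* w l)                         ≡⟨ ℤ.neg-distribˡ-* κ (w l) ⟩
      ℤ.- κ ℤ.* w l                           ∎
    κ≢0 : κ ≢ 0ℤ
    κ≢0 κ≡0 with c≢0
    ... | zero  , c₀≢0 = c₀≢0 κ≡0
    ... | suc k , cₖ≢0 = cₖ≢0 (punched-relation zero (c ∘ suc) S≡0 k)
      where
      S≡0 : ∀ l → S l ≡ 0ℤ
      S≡0 l = begin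
        S l                    ≡⟨ ℤ.+-identityˡ (S l) ⟨
        0ℤ ℤ.+ S l             ≡⟨ cong (ℤ._+ S l) (trans (cong (ℤ._* w l) κ≡0) (ℤ.*-zeroˡ (w l))) ⟨
        κ ℤ.* w l ℤ.+ S l      ≡⟨ relation l ⟩
        0ℤ                     ∎
    a≢0 : ∃ λ k → a k ≢ 0ℤ
    a≢0 = Fin.¬∀⟶∃¬ (suc d) (λ k → a k ≡ 0ℤ) (λ k → a k ℤ.≟ 0ℤ) λ a≡0 →
      product-nonZero κ (w l₀) κ≢0 w≢0 $ ℤ.neg-injective $ begin
        ℤ.- (κ ℤ.* w l₀)              ≡⟨ ℤ.neg-distribˡ-* κ (w l₀) ⟩
        ℤ.- κ ℤ.* w l₀                ≡⟨ combination l₀ ⟨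
        Σℤ (λ k → a k ℤ.* u k l₀)     ≡⟨ Σℤ-zero (λ k → trans (cong (ℤ._* u k l₀) (a≡0 k)) (ℤ.*-zeroˡ (u k l₀))) ⟩
        0ℤ                            ∎

  combine-relations : ∀ (w : Vector ℤ d) κ (a v : Vector ℤ (suc d)) x y → (∀ l → Σℤ (λ k → a k ℤ.* u k l) ≡ κ ℤ.* w l) →
    IntegerRelation u v → ∀ l → Σℤ (λ k → (x ℤ.* a k ℤ.+ y ℤ.* v k) ℤ.* u k l) ≡ x ℤ.* κ ℤ.* w l
  combine-relations w κ a v x y Ua≡κw Uv≡0 l = begin
    Σℤ (λ k → (x ℤ.* a k ℤ.+ y ℤ.* v k) ℤ.* u k l)
      ≡⟨ ℤΣ.sum-cong-≗ (λ k → split x (a k) y (v k) (u k l)) ⟩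
    Σℤ (λ k → x ℤ.* (a k ℤ.* u k l) ℤ.+ y ℤ.* (v k ℤ.* u k l))
      ≡⟨ ℤΣ.∑-distrib-+ (λ k → x ℤ.* (a k ℤ.* u k l)) (λ k → y ℤ.* (v k ℤ.* u k l)) ⟩
    Σℤ (λ k → x ℤ.* (a k ℤ.* u k l)) ℤ.+ Σℤ (λ k → y ℤ.* (v k ℤ.* u k l))
      ≡⟨ cong₂ ℤ._+_ (ℤΣ.*-distribˡ-sum x (λ k → a k ℤ.* u k l)) (ℤΣ.*-distribˡ-sum y (λ k → v k ℤ.* u k l)) ⟨
    x ℤ.* Σℤ (λ k → a k ℤ.* u k l) ℤ.+ y ℤ.* Σℤ (λ k → v k ℤ.* u k l)
      ≡⟨ cong₂ (λ p q → x ℤ.* p ℤ.+ y ℤ.* q) (Ua≡κw l) (Uv≡0 l) ⟩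
    x ℤ.* (κ ℤ.* w l) ℤ.+ y ℤ.* 0ℤ
      ≡⟨ finish x κ (w l) y ⟩
    x ℤ.* κ ℤ.* w l ∎
    where
    open ≡-Reasoning
    split : ∀ x a y v u → (x ℤ.* a ℤ.+ y ℤ.* v) ℤ.* u ≡ x ℤ.* (a ℤ.* u) ℤ.+ y ℤ.* (v ℤ.* u)
    split = ℤ-solve-∀
    finish : ∀ x κ w y → x ℤ.* (κ ℤ.* w) ℤ.+ y ℤ.* 0ℤ ≡ x ℤ.* κ ℤ.* w
    finish = ℤ-solve-∀

  record EqualSpeedsOver (w : Vector ℤ d) : Set where
    field
      velocity      : Vector ℤ (suc d)
      multiple      : ℤ
      velocity≢0    : ∀ k → velocity k ≢ 0ℤ
      equalSpeeds   : EqualSpeeds velocity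
      combination   : ∀ l → Σℤ (λ k → velocity k ℤ.* u k l) ≡ multiple ℤ.* w l

  equal-speeds-over : ∀ w → (∃ λ l → w l ≢ 0ℤ) → EqualSpeedsOver w
  equal-speeds-over w w≢0 = from-relation (nontrivial-relation u)
    where
    module _ (v : Vector ℤ (suc d)) (v≢0 : ∀ k → v k ≢ 0ℤ) (Uv≡0 : IntegerRelation u v) where
      from-crossing : ∀ a κ → (∀ l → Σℤ (λ k → a k ℤ.* u k l) ≡ κ ℤ.* w l) →
        (∃₂ λ x y → (∀ k → x ℤ.* a k ℤ.+ y ℤ.* v k ≢ 0ℤ) × EqualSpeeds (λ k → x ℤ.* a k ℤ.+ y ℤ.* v k)) →
        EqualSpeedsOver w
      from-crossing a κ Ua≡κw (x , y , v′≢0 , equal) = record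
        { velocity    = λ k → x ℤ.* a k ℤ.+ y ℤ.* v k
        ; multiple    = x ℤ.* κ
        ; velocity≢0  = v′≢0
        ; equalSpeeds = equal
        ; combination = combine-relations w κ a v x y Ua≡κw Uv≡0
        }
      from-coordinates : (∃₂ λ (a : Vector ℤ (suc d)) κ → a zero ≡ 0ℤ × (∃ λ k → a k ≢ 0ℤ) ×
        (∀ l → Σℤ (λ k → a k ℤ.* u k l) ≡ κ ℤ.* w l)) → EqualSpeedsOver w
      from-coordinates (a , κ , a₀≡0 , (k , aₖ≢0) , Ua≡κw) =
        from-crossing a κ Ua≡κw (equal-speeds a v v≢0 {zero} {k} λ eq →
          product-nonZero (a k) (v zero) aₖ≢0 (v≢0 zero)
            (trans (sym eq) (trans (cong (ℤ._* v k) a₀≡0) (ℤ.*-zeroˡ (v k)))))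
    from-relation : (∃ λ c → (∃ λ k → c k ≢ 0ℤ) × IntegerRelation u c) → EqualSpeedsOver w
    from-relation (v , v≢0∃ , Uv≡0) =
      from-coordinates v (relation-nonzero v Uv≡0 v≢0∃) Uv≡0 (coordinates w w≢0)

-- Perturbation into the larger cube

≈-refl : ∀ x → x ≈ x
≈-refl x = ~0⇒≈ {x} {x} (~0-cong (λ n → sym (ℚ.+-inverseʳ (seq x n))) ~0-0)

module ShrunkPoint {m} (Z : LonelyRunnerZonotope (suc (suc m))) (y : Vector ℝ (suc (suc m))) (K : Vector ℤ (suc m)) where

  open LonelyRunnerZonotope Z using () renaming (generators to u)
  open ≡-Reasoning

  ρ r r⁻¹ : ℚ
  ρ = 1/suc (suc (suc m))
  r = + suc m ℚ./ suc (suc (suc m))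

  r≢0 : r ≢ 0ℚ
  r≢0 = ℚ.<⇒≢ (ℚ.positive⁻¹ r {{ℚ.normalize-pos (suc m) (suc (suc (suc m)))}}) ∘ sym

  r⁻¹ = proj₁ (inverse r r≢0)

  r⁻¹r≡1 : r⁻¹ ℚ.* r ≡ 1ℚ
  r⁻¹r≡1 = proj₂ (inverse r r≢0)

  0≤r⁻¹ : 0ℚ ℚ.≤ r⁻¹
  0≤r⁻¹ = 1/-nonneg r r⁻¹ (0≤shrink-factor (suc m)) r⁻¹r≡1

  r⁻¹[1-2ρ]≡1 : r⁻¹ ℚ.* (1ℚ ℚ.- (ρ ℚ.+ ρ)) ≡ 1ℚ
  r⁻¹[1-2ρ]≡1 = subst (λ r → r⁻¹ ℚ.* r ≡ 1ℚ) (shrink-factor (suc m)) r⁻¹r≡1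

  -- Inverse of the contraction about ½: it stretches [ρ, 1 - ρ] to [0, 1].
  T : Vector ℝ (suc (suc m))
  T i = fromℚ r⁻¹ * (y i - fromℚ ½) + fromℚ ½

  0≤T : ∀ i → (λ n → ρ ℚ.- seq (y i) n) ≲0 → 0ℝ ≤ T i
  0≤T i ρ≲y = ≲0⇒≤ {0ℝ} {T i} (≲0-cong (λ n → trans (gap ρ r⁻¹ (seq (y i) n))
      (cong (λ h → 0ℚ ℚ.- (r⁻¹ ℚ.* (seq (y i) n ℚ.- ½) ℚ.+ h ℚ.* ½)) r⁻¹[1-2ρ]≡1))
    (≲0-scale 0≤r⁻¹ ρ≲y))
    where
    gap : ∀ ρ q y → q ℚ.* (ρ ℚ.- y) ≡ 0ℚ ℚ.- (q ℚ.* (y ℚ.- ½) ℚ.+ q ℚ.* (1ℚ ℚ.- (ρ ℚ.+ ρ)) ℚ.* ½)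
    gap = solve-∀ ℚ-ring

  T≤1 : ∀ i → (λ n → seq (y i) n ℚ.- (1ℚ ℚ.- ρ)) ≲0 → T i ≤ 1ℝ
  T≤1 i y≲1-ρ = ≲0⇒≤ {T i} {1ℝ} (≲0-cong (λ n → trans (gap ρ r⁻¹ (seq (y i) n))
      (cong (λ h → (r⁻¹ ℚ.* (seq (y i) n ℚ.- ½) ℚ.+ h ℚ.* ½) ℚ.- h) r⁻¹[1-2ρ]≡1))
    (≲0-scale 0≤r⁻¹ y≲1-ρ))
    where
    gap : ∀ ρ q y → q ℚ.* (y ℚ.- (1ℚ ℚ.- ρ)) ≡
      (q ℚ.* (y ℚ.- ½) ℚ.+ q ℚ.* (1ℚ ℚ.- (ρ ℚ.+ ρ)) ℚ.* ½) ℚ.- q ℚ.* (1ℚ ℚ.- (ρ ℚ.+ ρ))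
    gap = solve-∀ ℚ-ring

  q : Vector (Vector ℝ (suc m)) (suc (suc m))
  q i = (1ℝ - T i) • 𝟎 ⊕ T i • ι (u i)

  p : Vector ℝ (suc m)
  p = fromℚ r • (∑ q ⊖ center Z)

  -- With x the center, p = U y - x. If U y = K, this is x + (K - 2x), and 2x is the integer vector
  -- of the sum of the generators.
  K′ : Vector ℤ (suc m)
  K′ l = K l ℤ.- Σℤ (λ i → u i l)

  module _ (l : Fin (suc m)) where

    X : ℚ
    X = Σℚ (λ i → ⟦ u i l ⟧)

    Y : ℕ → ℚ
    Y n = Σℚ (λ i → seq (y i) n ℚ.* ⟦ u i l ⟧)

    ∑q≡ : ∀ n → seq (∑ q l) n ≡ r⁻¹ ℚ.* Y n ℚ.+ (½ ℚ.- r⁻¹ ℚ.* ½) ℚ.* X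
    ∑q≡ n = begin
      seq (∑ q l) n
        ≡⟨ seq-sum (λ i → q i l) n ⟩
      Σℚ (λ i → seq (q i l) n)
        ≡⟨ ℚΣ.sum-cong-≗ (λ i → split r⁻¹ (seq (y i) n) ⟦ u i l ⟧) ⟩
      Σℚ (λ i → r⁻¹ ℚ.* (seq (y i) n ℚ.* ⟦ u i l ⟧) ℚ.+ (½ ℚ.- r⁻¹ ℚ.* ½) ℚ.* ⟦ u i l ⟧)
        ≡⟨ ℚΣ.∑-distrib-+ (λ i → r⁻¹ ℚ.* (seq (y i) n ℚ.* ⟦ u i l ⟧)) (λ i → (½ ℚ.- r⁻¹ ℚ.* ½) ℚ.* ⟦ u i l ⟧) ⟩
      Σℚ (λ i → r⁻¹ ℚ.* (seq (y i) n ℚ.* ⟦ u i l ⟧)) ℚ.+ Σℚ (λ i → (½ ℚ.- r⁻¹ ℚ.* ½) ℚ.* ⟦ u i l ⟧)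
        ≡⟨ cong₂ ℚ._+_ (ℚΣ.*-distribˡ-sum r⁻¹ (λ i → seq (y i) n ℚ.* ⟦ u i l ⟧))
             (ℚΣ.*-distribˡ-sum (½ ℚ.- r⁻¹ ℚ.* ½) (λ i → ⟦ u i l ⟧)) ⟨
      r⁻¹ ℚ.* Y n ℚ.+ (½ ℚ.- r⁻¹ ℚ.* ½) ℚ.* X ∎
      where
      split : ∀ q y u → (1ℚ ℚ.- (q ℚ.* (y ℚ.- ½) ℚ.+ ½)) ℚ.* 0ℚ ℚ.+ (q ℚ.* (y ℚ.- ½) ℚ.+ ½) ℚ.* u ≡
        q ℚ.* (y ℚ.* u) ℚ.+ (½ ℚ.- q ℚ.* ½) ℚ.* u
      split = solve-∀ ℚ-ring

    center≡ : ∀ n → seq (center Z l) n ≡ ½ ℚ.* X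
    center≡ n = cong (½ ℚ.*_) (seq-sum (λ i → fromℤ (u i l)) n)

    K′≡ : ⟦ K′ l ⟧ ≡ ⟦ K l ⟧ ℚ.- X
    K′≡ = trans (⟦⟧-+ (K l) (ℤ.- S)) (cong (⟦ K l ⟧ ℚ.+_) (trans (⟦⟧-neg S) (cong (λ x → ℚ.- x) (⟦⟧-Σ (λ i → u i l)))))
      where S = Σℤ (λ i → u i l)

    difference : ∀ n → Y n ℚ.- ⟦ K l ⟧ ≡ seq (p l) n ℚ.- (seq (center Z l) n ℚ.+ ⟦ K′ l ⟧)
    difference n = sym $ begin
      r ℚ.* (seq (∑ q l) n ℚ.- seq (center Z l) n) ℚ.- (seq (center Z l) n ℚ.+ ⟦ K′ l ⟧)
        ≡⟨ cong₂ (λ s c → r ℚ.* (s ℚ.- c) ℚ.- (c ℚ.+ ⟦ K′ l ⟧)) (∑q≡ n) (center≡ n) ⟩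
      r ℚ.* ((r⁻¹ ℚ.* Y n ℚ.+ (½ ℚ.- r⁻¹ ℚ.* ½) ℚ.* X) ℚ.- ½ ℚ.* X) ℚ.- (½ ℚ.* X ℚ.+ ⟦ K′ l ⟧)
        ≡⟨ cong (λ k → r ℚ.* ((r⁻¹ ℚ.* Y n ℚ.+ (½ ℚ.- r⁻¹ ℚ.* ½) ℚ.* X) ℚ.- ½ ℚ.* X) ℚ.- (½ ℚ.* X ℚ.+ k)) K′≡ ⟩
      r ℚ.* ((r⁻¹ ℚ.* Y n ℚ.+ (½ ℚ.- r⁻¹ ℚ.* ½) ℚ.* X) ℚ.- ½ ℚ.* X) ℚ.- (½ ℚ.* X ℚ.+ (⟦ K l ⟧ ℚ.- X))
        ≡⟨ regroup r r⁻¹ (Y n) X ⟦ K l ⟧ ⟩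
      r⁻¹ ℚ.* r ℚ.* (Y n ℚ.- ½ ℚ.* X) ℚ.+ ½ ℚ.* X ℚ.- ⟦ K l ⟧
        ≡⟨ cong (λ h → h ℚ.* (Y n ℚ.- ½ ℚ.* X) ℚ.+ ½ ℚ.* X ℚ.- ⟦ K l ⟧) r⁻¹r≡1 ⟩
      1ℚ ℚ.* (Y n ℚ.- ½ ℚ.* X) ℚ.+ ½ ℚ.* X ℚ.- ⟦ K l ⟧
        ≡⟨ collapse (Y n) X ⟦ K l ⟧ ⟩
      Y n ℚ.- ⟦ K l ⟧ ∎
      where
      regroup : ∀ r q y x k →
        r ℚ.* ((q ℚ.* y ℚ.+ (½ ℚ.- q ℚ.* ½) ℚ.* x) ℚ.- ½ ℚ.* x) ℚ.- (½ ℚ.* x ℚ.+ (k ℚ.- x)) ≡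
        q ℚ.* r ℚ.* (y ℚ.- ½ ℚ.* x) ℚ.+ ½ ℚ.* x ℚ.- k
      regroup = solve-∀ ℚ-ring
      collapse : ∀ y x k → 1ℚ ℚ.* (y ℚ.- ½ ℚ.* x) ℚ.+ ½ ℚ.* x ℚ.- k ≡ y ℚ.- k
      collapse = solve-∀ ℚ-ring

  shrunkPoint : (∀ i → (λ n → ρ ℚ.- seq (y i) n) ≲0) → (∀ i → (λ n → seq (y i) n ℚ.- (1ℚ ℚ.- ρ)) ≲0) →
    (∀ l → (λ n → Y l n ℚ.- ⟦ K l ⟧) ~0) → Satisfiable (shrunkCosetPoints Z)
  shrunkPoint ρ≲y y≲1-ρ Y~K = p ,
    (∑ q , (q , (λ i → T i , 0≤T i (ρ≲y i) , T≤1 i (y≲1-ρ i) , λ l → ≈-refl (q i l)) , λ l → ≈-refl (∑ q l)) ,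
      λ l → ≈-refl (p l)) ,
    (K′ , λ l → ~0⇒≈ {p l} {center Z l + fromℤ (K′ l)} (~0-cong (difference l) (Y~K l)))

≤⇒diff≤0 : ∀ {p q} → p ℚ.≤ q → p ℚ.- q ℚ.≤ 0ℚ
≤⇒diff≤0 {p} {q} p≤q = subst (p ℚ.- q ℚ.≤_) (ℚ.+-inverseʳ q) (ℚ.+-monoˡ-≤ (ℚ.- q) p≤q)

-- The difference of two numbers in [0, 1] lies between -1 and 1; the sign of the rational `β` tells
-- which of the two bounds to use.
scaled-difference : ∀ β e {t t′} → 0ℝ ≤ t × t ≤ 1ℝ → 0ℝ ≤ t′ × t′ ≤ 1ℝ → β ℚ.≤ e → ℚ.- β ℚ.≤ e →
  (λ n → β ℚ.* (seq t n ℚ.- seq t′ n) ℚ.- e) ≲0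
scaled-difference β e {t} {t′} (0≤t , t≤1) (0≤t′ , t′≤1) β≤e -β≤e with ℚ.≤-total 0ℚ β
... | inj₁ 0≤β = ≲0-cong (λ n → gather β e (seq t n) (seq t′ n))
  (≲0-+ (≲0-scale 0≤β (≲0-+ (≤⇒≲0 {t} {1ℝ} t≤1) (≤⇒≲0 {0ℝ} {t′} 0≤t′))) 
    (≲0-const (≤⇒diff≤0 β≤e)))
  where
  gather : ∀ β e t t′ → β ℚ.* ((t ℚ.- 1ℚ) ℚ.+ (0ℚ ℚ.- t′)) ℚ.+ (β ℚ.- e) ≡ β ℚ.* (t ℚ.- t′) ℚ.- e
  gather = solve-∀ ℚ-ring
... | inj₂ β≤0 = ≲0-cong (λ n → gather β e (seq t n) (seq t′ n))
  (≲0-+ (≲0-scale (0≤-neg β≤0) (≲0-+ (≤⇒≲0 {t′} {1ℝ} t′≤1) (≤⇒≲0 {0ℝ} {t} 0≤t)))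
    (≲0-const (≤⇒diff≤0 -β≤e)))
  where
  gather : ∀ β e t t′ → ℚ.- β ℚ.* ((t′ ℚ.- 1ℚ) ℚ.+ (0ℚ ℚ.- t)) ℚ.+ (ℚ.- β ℚ.- e) ≡ β ℚ.* (t ℚ.- t′) ℚ.- e
  gather = solve-∀ ℚ-ring

nearest-integer : ∀ x → ∃ λ M → ⟦ M ⟧ ℚ.- x ℚ.≤ ½ × ℚ.- (⟦ M ⟧ ℚ.- x) ℚ.≤ ½
nearest-integer x = ℚ.floor (x ℚ.+ ½) ,
  0≤diff⁻¹ (subst (0ℚ ℚ.≤_) (above M x) (0≤diff (proj₁ (floor-bounds (x ℚ.+ ½))))) ,
  0≤diff⁻¹ (subst (0ℚ ℚ.≤_) (below M x) (0≤diff (proj₂ (floor-bounds (x ℚ.+ ½)))))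
  where
  M = ⟦ ℚ.floor (x ℚ.+ ½) ⟧
  above : ∀ M x → (x ℚ.+ ½) ℚ.- M ≡ ½ ℚ.- (M ℚ.- x)
  above = solve-∀ ℚ-ring
  below : ∀ M x → (M ℚ.+ 1ℚ) ℚ.- (x ℚ.+ ½) ≡ ½ ℚ.- (ℚ.- (M ℚ.- x))
  below = solve-∀ ℚ-ring

module Reciprocals (n N : ℕ) (2N≡n[n+1] : 2 ℕ.* N ≡ suc n ℕ.* suc (suc n)) where

  open ≡-Reasoning

  -- `suc n` is the number of generators, so ρ and ρ′ are the distances before and after the
  -- correction. `η` is 1/N in the form 2 ρ ρ′, which makes its half the gap ρ - ρ′.
  ρ ρ′ η n̂ : ℚ
  ρ  = 1/suc n
  ρ′ = 1/suc (suc n)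
  η  = ρ ℚ.* ρ′ ℚ.+ ρ ℚ.* ρ′
  n̂  = ⟦ + suc n ⟧

  n̂ρ≡1 : n̂ ℚ.* ρ ≡ 1ℚ
  n̂ρ≡1 = suc*1/suc n

  [1+n̂]ρ′≡1 : (1ℚ ℚ.+ n̂) ℚ.* ρ′ ≡ 1ℚ
  [1+n̂]ρ′≡1 = trans (cong (ℚ._* ρ′) (sym (⟦⟧-+ 1ℤ (+ suc n)))) (suc*1/suc (suc n))

  ρ-ρ′≡ρρ′ : ρ ℚ.- ρ′ ≡ ρ ℚ.* ρ′
  ρ-ρ′≡ρρ′ = begin
    ρ ℚ.- ρ′
      ≡⟨ units ρ ρ′ ⟩
    1ℚ ℚ.* ρ ℚ.- 1ℚ ℚ.* ρ′
      ≡⟨ cong₂ (λ a b → a ℚ.* ρ ℚ.- b ℚ.* ρ′) [1+n̂]ρ′≡1 n̂ρ≡1 ⟨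
    (1ℚ ℚ.+ n̂) ℚ.* ρ′ ℚ.* ρ ℚ.- n̂ ℚ.* ρ ℚ.* ρ′
      ≡⟨ collapse n̂ ρ ρ′ ⟩
    ρ ℚ.* ρ′ ∎
    where
    units : ∀ a b → a ℚ.- b ≡ 1ℚ ℚ.* a ℚ.- 1ℚ ℚ.* b
    units = solve-∀ ℚ-ring
    collapse : ∀ n a b → (1ℚ ℚ.+ n) ℚ.* b ℚ.* a ℚ.- n ℚ.* a ℚ.* b ≡ a ℚ.* b
    collapse = solve-∀ ℚ-ring

  2N̂≡n̂[1+n̂] : ⟦ + N ⟧ ℚ.+ ⟦ + N ⟧ ≡ n̂ ℚ.* (1ℚ ℚ.+ n̂)
  2N̂≡n̂[1+n̂] = begin
    ⟦ + N ⟧ ℚ.+ ⟦ + N ⟧             ≡⟨ ⟦⟧-+ (+ N) (+ N) ⟨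
    ⟦ + (N ℕ.+ N) ⟧                 ≡⟨ cong (λ k → ⟦ + (N ℕ.+ k) ⟧) (ℕ.+-identityʳ N) ⟨
    ⟦ + (2 ℕ.* N) ⟧                 ≡⟨ cong (λ k → ⟦ + k ⟧) 2N≡n[n+1] ⟩
    ⟦ + (suc n ℕ.* suc (suc n)) ⟧   ≡⟨ cong ⟦_⟧ (ℤ.pos-* (suc n) (suc (suc n))) ⟩
    ⟦ + suc n ℤ.* + suc (suc n) ⟧   ≡⟨ ⟦⟧-* (+ suc n) (+ suc (suc n)) ⟩
    n̂ ℚ.* ⟦ + suc (suc n) ⟧         ≡⟨ cong (n̂ ℚ.*_) (⟦⟧-+ 1ℤ (+ suc n)) ⟩
    n̂ ℚ.* (1ℚ ℚ.+ n̂)                ∎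

  ηN̂≡1 : η ℚ.* ⟦ + N ⟧ ≡ 1ℚ
  ηN̂≡1 = begin
    η ℚ.* ⟦ + N ⟧                                ≡⟨ double ρ ρ′ ⟦ + N ⟧ ⟩
    ρ ℚ.* ρ′ ℚ.* (⟦ + N ⟧ ℚ.+ ⟦ + N ⟧)           ≡⟨ cong (ρ ℚ.* ρ′ ℚ.*_) 2N̂≡n̂[1+n̂] ⟩
    ρ ℚ.* ρ′ ℚ.* (n̂ ℚ.* (1ℚ ℚ.+ n̂))              ≡⟨ regroup ρ ρ′ n̂ ⟩
    n̂ ℚ.* ρ ℚ.* ((1ℚ ℚ.+ n̂) ℚ.* ρ′)              ≡⟨ cong₂ ℚ._*_ n̂ρ≡1 [1+n̂]ρ′≡1 ⟩
    1ℚ                                           ∎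
    where
    double : ∀ a b N → (a ℚ.* b ℚ.+ a ℚ.* b) ℚ.* N ≡ a ℚ.* b ℚ.* (N ℚ.+ N)
    double = solve-∀ ℚ-ring
    regroup : ∀ a b n → a ℚ.* b ℚ.* (n ℚ.* (1ℚ ℚ.+ n)) ≡ n ℚ.* a ℚ.* ((1ℚ ℚ.+ n) ℚ.* b)
    regroup = solve-∀ ℚ-ring

  scaled≤ρρ′ : ∀ s → s ℚ.≤ ½ → s ℚ.* η ℚ.≤ ρ ℚ.* ρ′
  scaled≤ρρ′ s s≤½ = 0≤diff⁻¹ (subst (0ℚ ℚ.≤_) (gap s (ρ ℚ.* ρ′)) (0≤-* (0≤diff s≤½) 0≤η))
    where
    0≤ρρ′ : 0ℚ ℚ.≤ ρ ℚ.* ρ′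
    0≤ρρ′ = 0≤-* (0≤1/suc n) (0≤1/suc (suc n))
    0≤η : 0ℚ ℚ.≤ η
    0≤η = ℚ.+-mono-≤ 0≤ρρ′ 0≤ρρ′
    gap : ∀ s e → (½ ℚ.- s) ℚ.* (e ℚ.+ e) ≡ e ℚ.- s ℚ.* (e ℚ.+ e)
    gap = solve-∀ ℚ-ring

module Perturbation {d n} (u : Vector (Vector ℤ d) n) (ρ ρ′ e β : ℚ) (ρ-ρ′≡e : ρ ℚ.- ρ′ ≡ e)
  (β≤ : β ℚ.≤ e) (-β≤ : ℚ.- β ℚ.≤ e)
  (t t′ : Vector ℝ n) (t∈ : ∀ i → 0ℝ ≤ t i × t i ≤ 1ℝ) (t′∈ : ∀ i → 0ℝ ≤ t′ i × t′ i ≤ 1ℝ)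
  (v z : Vector ℤ n) (τ : ℚ)
  where

  open ≡-Reasoning

  c : Vector ℚ n
  c k = τ ℚ.* ⟦ v k ⟧ ℚ.+ ⟦ z k ⟧

  y : Vector ℝ n
  y i = fromℚ (c i) + fromℚ β * (t i - t′ i)

  ρ′≲y : ∀ i → ρ ℚ.≤ c i → (λ j → ρ′ ℚ.- seq (y i) j) ≲0
  ρ′≲y i ρ≤c = ≲0-cong (λ j → trans (cong (λ e → (ρ ℚ.- c i) ℚ.+ (ℚ.- β ℚ.* (seq (t i) j ℚ.- seq (t′ i) j) ℚ.- e)) (sym ρ-ρ′≡e))
      (gap ρ ρ′ (c i) β (seq (t i) j) (seq (t′ i) j)))
    (≲0-+ (≲0-const (≤⇒diff≤0 ρ≤c))
      (scaled-difference (ℚ.- β) (e) {t i} {t′ i} (t∈ i) (t′∈ i) -β≤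
        (subst (ℚ._≤ e) (sym (neg-neg β)) β≤)))
    where
    neg-neg : ∀ a → ℚ.- (ℚ.- a) ≡ a
    neg-neg = solve-∀ ℚ-ring
    gap : ∀ ρ ρ′ c β t t′ → (ρ ℚ.- c) ℚ.+ (ℚ.- β ℚ.* (t ℚ.- t′) ℚ.- (ρ ℚ.- ρ′)) ≡ ρ′ ℚ.- (c ℚ.+ β ℚ.* (t ℚ.- t′))
    gap = solve-∀ ℚ-ring

  y≲1-ρ′ : ∀ i → c i ℚ.≤ 1ℚ ℚ.- ρ → (λ j → seq (y i) j ℚ.- (1ℚ ℚ.- ρ′)) ≲0
  y≲1-ρ′ i c≤1-ρ = ≲0-cong (λ j → trans (cong (λ e → (c i ℚ.- (1ℚ ℚ.- ρ)) ℚ.+ (β ℚ.* (seq (t i) j ℚ.- seq (t′ i) j) ℚ.- e)) (sym ρ-ρ′≡e))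
      (gap ρ ρ′ (c i) β (seq (t i) j) (seq (t′ i) j)))
    (≲0-+ (≲0-const (≤⇒diff≤0 c≤1-ρ))
      (scaled-difference β (e) {t i} {t′ i} (t∈ i) (t′∈ i) β≤ -β≤))
    where
    gap : ∀ ρ ρ′ c β t t′ → (c ℚ.- (1ℚ ℚ.- ρ)) ℚ.+ (β ℚ.* (t ℚ.- t′) ℚ.- (ρ ℚ.- ρ′)) ≡
      (c ℚ.+ β ℚ.* (t ℚ.- t′)) ℚ.- (1ℚ ℚ.- ρ′)
    gap = solve-∀ ℚ-ring

  module _ (κ M : ℤ) (N : ℕ) (w P P′ : Vector ℤ d) (βN≡ : β ℚ.* ⟦ + N ⟧ ≡ ⟦ M ⟧ ℚ.- τ ℚ.* ⟦ κ ⟧) (l : Fin d)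
    (Uv≡κw : Σℤ (λ k → v k ℤ.* u k l) ≡ κ ℤ.* w l) (P≡ : P l ≡ P′ l ℤ.+ w l ℤ.* + N)
    (Ut~P : (λ j → Σℚ (λ i → seq (t i) j ℚ.* ⟦ u i l ⟧) ℚ.- ⟦ P l ⟧) ~0)
    (Ut′~P′ : (λ j → Σℚ (λ i → seq (t′ i) j ℚ.* ⟦ u i l ⟧) ℚ.- ⟦ P′ l ⟧) ~0)
    where

    S S′ : ℕ → ℚ
    S j = Σℚ (λ i → seq (t i) j ℚ.* ⟦ u i l ⟧)
    S′ j = Σℚ (λ i → seq (t′ i) j ℚ.* ⟦ u i l ⟧)

    zu : ℚ
    zu = Σℚ (λ i → ⟦ z i ⟧ ℚ.* ⟦ u i l ⟧)

    vu≡ : Σℚ (λ i → ⟦ v i ⟧ ℚ.* ⟦ u i l ⟧) ≡ ⟦ κ ⟧ ℚ.* ⟦ w l ⟧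
    vu≡ = trans (sym (⟦⟧-Σ* v (λ i → u i l))) (trans (cong ⟦_⟧ Uv≡κw) (⟦⟧-* κ (w l)))

    yu≡ : ∀ j → Σℚ (λ i → seq (y i) j ℚ.* ⟦ u i l ⟧) ≡
      τ ℚ.* (⟦ κ ⟧ ℚ.* ⟦ w l ⟧) ℚ.+ zu ℚ.+ (β ℚ.* S j ℚ.+ ℚ.- β ℚ.* S′ j)
    yu≡ j = begin
      Σℚ (λ i → seq (y i) j ℚ.* U i)
        ≡⟨ ℚΣ.sum-cong-≗ (λ i → split τ ⟦ v i ⟧ ⟦ z i ⟧ β (T i) (T′ i) (U i)) ⟩
      Σℚ (λ i → (τ ℚ.* (⟦ v i ⟧ ℚ.* U i) ℚ.+ ⟦ z i ⟧ ℚ.* U i) ℚ.+ (β ℚ.* (T i ℚ.* U i) ℚ.+ ℚ.- β ℚ.* (T′ i ℚ.* U i)))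
        ≡⟨ ℚΣ.∑-distrib-+ (λ i → τ ℚ.* (⟦ v i ⟧ ℚ.* U i) ℚ.+ ⟦ z i ⟧ ℚ.* U i)
             (λ i → β ℚ.* (T i ℚ.* U i) ℚ.+ ℚ.- β ℚ.* (T′ i ℚ.* U i)) ⟩
      Σℚ (λ i → τ ℚ.* (⟦ v i ⟧ ℚ.* U i) ℚ.+ ⟦ z i ⟧ ℚ.* U i) ℚ.+
        Σℚ (λ i → β ℚ.* (T i ℚ.* U i) ℚ.+ ℚ.- β ℚ.* (T′ i ℚ.* U i))
        ≡⟨ cong₂ ℚ._+_ (ℚΣ.∑-distrib-+ (λ i → τ ℚ.* (⟦ v i ⟧ ℚ.* U i)) (λ i → ⟦ z i ⟧ ℚ.* U i))
             (ℚΣ.∑-distrib-+ (λ i → β ℚ.* (T i ℚ.* U i)) (λ i → ℚ.- β ℚ.* (T′ i ℚ.* U i))) ⟩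
      Σℚ (λ i → τ ℚ.* (⟦ v i ⟧ ℚ.* U i)) ℚ.+ zu ℚ.+
        (Σℚ (λ i → β ℚ.* (T i ℚ.* U i)) ℚ.+ Σℚ (λ i → ℚ.- β ℚ.* (T′ i ℚ.* U i)))
        ≡⟨ cong₂ (λ a b → a ℚ.+ zu ℚ.+ b)
             (trans (sym (ℚΣ.*-distribˡ-sum τ (λ i → ⟦ v i ⟧ ℚ.* U i))) (cong (τ ℚ.*_) vu≡))
             (cong₂ ℚ._+_ (sym (ℚΣ.*-distribˡ-sum β (λ i → T i ℚ.* U i)))
               (sym (ℚΣ.*-distribˡ-sum (ℚ.- β) (λ i → T′ i ℚ.* U i)))) ⟩
      τ ℚ.* (⟦ κ ⟧ ℚ.* ⟦ w l ⟧) ℚ.+ zu ℚ.+ (β ℚ.* S j ℚ.+ ℚ.- β ℚ.* S′ j) ∎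
      where
      T T′ U : Fin n → ℚ
      T i = seq (t i) j
      T′ i = seq (t′ i) j
      U i = ⟦ u i l ⟧
      split : ∀ τ v z β t t′ u → (τ ℚ.* v ℚ.+ z ℚ.+ β ℚ.* (t ℚ.- t′)) ℚ.* u ≡
        (τ ℚ.* (v ℚ.* u) ℚ.+ z ℚ.* u) ℚ.+ (β ℚ.* (t ℚ.* u) ℚ.+ ℚ.- β ℚ.* (t′ ℚ.* u))
      split = solve-∀ ℚ-ring

    K : ℤ
    K = M ℤ.* w l ℤ.+ Σℤ (λ k → z k ℤ.* u k l)

    K≡ : ⟦ K ⟧ ≡ ⟦ M ⟧ ℚ.* ⟦ w l ⟧ ℚ.+ zu
    K≡ = trans (⟦⟧-+ (M ℤ.* w l) (Σℤ (λ k → z k ℤ.* u k l)))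
      (cong₂ ℚ._+_ (⟦⟧-* M (w l)) (⟦⟧-Σ* z (λ k → u k l)))

    P̂≡ : ⟦ P l ⟧ ≡ ⟦ P′ l ⟧ ℚ.+ ⟦ w l ⟧ ℚ.* ⟦ + N ⟧
    P̂≡ = trans (cong ⟦_⟧ P≡) (trans (⟦⟧-+ (P′ l) (w l ℤ.* + N)) (cong (⟦ P′ l ⟧ ℚ.+_) (⟦⟧-* (w l) (+ N))))

    -- U c = τ κ w + U z and U (t - t′) = N w, so U y = (τ κ + β N) w + U z. The value of β N rounds
    -- τ κ to the integer `M`, which leaves the integer vector M w + U z.
    y~K : (λ j → Σℚ (λ i → seq (y i) j ℚ.* ⟦ u i l ⟧) ℚ.- ⟦ K ⟧) ~0
    y~K = ~0-cong identity
      (~0-scale β (~0-+ Ut~P (~0-neg Ut′~P′)))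
      where
      expand : ∀ β S P′ w N S′ → β ℚ.* ((S ℚ.- (P′ ℚ.+ w ℚ.* N)) ℚ.+ ℚ.- (S′ ℚ.- P′)) ≡
        (β ℚ.* S ℚ.+ ℚ.- β ℚ.* S′) ℚ.- β ℚ.* N ℚ.* w
      expand = solve-∀ ℚ-ring
      regroup : ∀ D M τ κ w zu → D ℚ.- (M ℚ.- τ ℚ.* κ) ℚ.* w ≡
        (τ ℚ.* (κ ℚ.* w) ℚ.+ zu ℚ.+ D) ℚ.- (M ℚ.* w ℚ.+ zu)
      regroup = solve-∀ ℚ-ring
      identity : ∀ j → β ℚ.* ((S j ℚ.- ⟦ P l ⟧) ℚ.+ ℚ.- (S′ j ℚ.- ⟦ P′ l ⟧)) ≡
        Σℚ (λ i → seq (y i) j ℚ.* ⟦ u i l ⟧) ℚ.- ⟦ K ⟧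
      identity j = begin
        β ℚ.* ((S j ℚ.- ⟦ P l ⟧) ℚ.+ ℚ.- (S′ j ℚ.- ⟦ P′ l ⟧))
          ≡⟨ cong (λ p → β ℚ.* ((S j ℚ.- p) ℚ.+ ℚ.- (S′ j ℚ.- ⟦ P′ l ⟧))) P̂≡ ⟩
        β ℚ.* ((S j ℚ.- (⟦ P′ l ⟧ ℚ.+ ⟦ w l ⟧ ℚ.* ⟦ + N ⟧)) ℚ.+ ℚ.- (S′ j ℚ.- ⟦ P′ l ⟧))
          ≡⟨ expand β (S j) ⟦ P′ l ⟧ ⟦ w l ⟧ ⟦ + N ⟧ (S′ j) ⟩
        D ℚ.- β ℚ.* ⟦ + N ⟧ ℚ.* ⟦ w l ⟧
          ≡⟨ cong (λ b → D ℚ.- b ℚ.* ⟦ w l ⟧) βN≡ ⟩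
        D ℚ.- (⟦ M ⟧ ℚ.- τ ℚ.* ⟦ κ ⟧) ℚ.* ⟦ w l ⟧
          ≡⟨ regroup D ⟦ M ⟧ τ ⟦ κ ⟧ ⟦ w l ⟧ zu ⟩
        (τ ℚ.* (⟦ κ ⟧ ℚ.* ⟦ w l ⟧) ℚ.+ zu ℚ.+ D) ℚ.- (⟦ M ⟧ ℚ.* ⟦ w l ⟧ ℚ.+ zu)
          ≡⟨ cong₂ ℚ._-_ (yu≡ j) K≡ ⟨
        Σℚ (λ i → seq (y i) j ℚ.* ⟦ u i l ⟧) ℚ.- ⟦ K ⟧ ∎
        where D = β ℚ.* S j ℚ.+ ℚ.- β ℚ.* S′ j

-- From two congruent lattice points to a point of the shrunk zonotope

module ManyPoints {m N} (2N≡n[n+1] : 2 ℕ.* N ≡ suc (suc m) ℕ.* suc (suc (suc m)))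
  (conjecture : ConjectureB (suc m)) (Z : LonelyRunnerZonotope (suc (suc m)))
  (w P P′ : Vector ℤ (suc m)) (w≢0 : ∃ λ l → w l ≢ 0ℤ) (P≡ : ∀ l → P l ≡ P′ l ℤ.+ w l ℤ.* + N)
  (P∈Z : ι P ∈ points Z) (P′∈Z : ι P′ ∈ points Z) where

  open LonelyRunnerZonotope Z using () renaming (generators to u; generalPosition to u-generic)
  open Reciprocals (suc m) N 2N≡n[n+1]

  module _ (v : Vector ℤ (suc (suc m))) (κ : ℤ) (Uv≡κw : ∀ l → Σℤ (λ k → v k ℤ.* u k l) ≡ κ ℤ.* w l)
    (τ : ℚ) (far : ∀ k → AwayFromIntegers ρ (τ ℚ.* ⟦ v k ⟧))
    (M : ℤ) (s≤½ : ⟦ M ⟧ ℚ.- τ ℚ.* ⟦ κ ⟧ ℚ.≤ ½) (-s≤½ : ℚ.- (⟦ M ⟧ ℚ.- τ ℚ.* ⟦ κ ⟧) ℚ.≤ ½)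
    (t t′ : Vector ℝ (suc (suc m))) (t∈ : ∀ i → 0ℝ ≤ t i × t i ≤ 1ℝ) (t′∈ : ∀ i → 0ℝ ≤ t′ i × t′ i ≤ 1ℝ)
    (Ut~P : ∀ l → (λ j → Σℚ (λ i → seq (t i) j ℚ.* ⟦ u i l ⟧) ℚ.- ⟦ P l ⟧) ~0)
    (Ut′~P′ : ∀ l → (λ j → Σℚ (λ i → seq (t′ i) j ℚ.* ⟦ u i l ⟧) ℚ.- ⟦ P′ l ⟧) ~0)
    where

    s : ℚ
    s = ⟦ M ⟧ ℚ.- τ ℚ.* ⟦ κ ⟧

    z : Vector ℤ (suc (suc m))
    z k = AwayFromIntegers.shift (far k)

    sηN≡s : s ℚ.* η ℚ.* ⟦ + N ⟧ ≡ s
    sηN≡s = trans (ℚ.*-assoc s η ⟦ + N ⟧) (trans (cong (s ℚ.*_) ηN̂≡1) (ℚ.*-identityʳ s))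

    open Perturbation u ρ ρ′ (ρ ℚ.* ρ′) (s ℚ.* η) ρ-ρ′≡ρρ′ (scaled≤ρρ′ s s≤½)
      (subst (ℚ._≤ ρ ℚ.* ρ′) (sym (ℚ.neg-distribˡ-* s η)) (scaled≤ρρ′ (ℚ.- s) -s≤½))
      t t′ t∈ t′∈ v z τ

    perturbedPoint : Satisfiable (shrunkCosetPoints Z)
    perturbedPoint = ShrunkPoint.shrunkPoint Z y
      (λ l → M ℤ.* w l ℤ.+ Σℤ (λ k → z k ℤ.* u k l))
      (λ i → ρ′≲y i (AwayFromIntegers.ρ≤ (far i)))
      (λ i → y≲1-ρ′ i (AwayFromIntegers.≤1-ρ (far i)))
      (λ l → y~K κ M N w P P′ sηN≡s l (Uv≡κw l) (P≡ l) (Ut~P l) (Ut′~P′ l))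

  shrunkPoint : Satisfiable (shrunkCosetPoints Z)
  shrunkPoint = from-velocities (GeneralPosition.equal-speeds-over u u-generic w w≢0)
    where
    from-velocities : GeneralPosition.EqualSpeedsOver u u-generic w → Satisfiable (shrunkCosetPoints Z)
    from-velocities O = from-time (lonely-with-equal-speeds conjecture velocity velocity≢0 equalSpeeds)
      where
      open GeneralPosition.EqualSpeedsOver O
      from-time : (∃ λ τ → ∀ k → AwayFromIntegers ρ (τ ℚ.* ⟦ velocity k ⟧)) → Satisfiable (shrunkCosetPoints Z)
      from-time (τ , far) = from-rounding (nearest-integer (τ ℚ.* ⟦ multiple ⟧))
        where
        from-rounding : (∃ λ M → ⟦ M ⟧ ℚ.- τ ℚ.* ⟦ multiple ⟧ ℚ.≤ ½ × ℚ.- (⟦ M ⟧ ℚ.- τ ℚ.* ⟦ multiple ⟧) ℚ.≤ ½) →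
          Satisfiable (shrunkCosetPoints Z)
        from-rounding (M , s≤½ , -s≤½) =
          from-coefficients (zonotope-combination u (ι P) P∈Z) (zonotope-combination u (ι P′) P′∈Z)
          where
          Coefficients : Vector ℤ (suc m) → Set
          Coefficients Q = ∃ λ (t : Vector ℝ (suc (suc m))) → (∀ i → 0ℝ ≤ t i × t i ≤ 1ℝ) ×
            (∀ l → (λ j → Σℚ (λ i → seq (t i) j ℚ.* ⟦ u i l ⟧) ℚ.- ⟦ Q l ⟧) ~0)
          from-coefficients : Coefficients P → Coefficients P′ → Satisfiable (shrunkCosetPoints Z)
          from-coefficients (t , t∈ , Ut~P) (t′ , t′∈ , Ut′~P′) =
            perturbedPoint velocity multiple combination τ far M s≤½ -s≤½ t t′ t∈ t′∈ Ut~P Ut′~P′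

theorem1 : (n : ℕ) → n ≥ 1 → ConjectureB (n ∸ 1) →
    (Z : LonelyRunnerZonotope n) → ViolatesConjectureB Z →
    ContainsAtMost ((suc n C 2) ^ (n ∸ 1)) LatticePoints (points Z)
theorem1 zero () _ _ _ _ _ _ _
-- For n = 1 the bound is 1. Vectors without entries agree pointwise, so injectivity of `p` rules
-- out two indices.
theorem1 (suc zero) _ _ _ _ zero _ _ _ = ℕ.z≤n
theorem1 (suc zero) _ _ _ _ (suc zero) _ _ _ = ℕ.≤-refl
theorem1 (suc zero) _ _ _ _ (suc (suc k)) p p-injective _
  with () ← p-injective {zero} {suc zero} (λ ())
theorem1 n@(suc (suc m)) _ conjecture Z violates k p p-injective p∈Z = ℕ.≮⇒≥ λ N^d<k →
  let i , j , w , w≢0 , p≡ = congruent-pair N {{N≢0}} N^d<k p p-injective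
      q , q∈ = ManyPoints.shrunkPoint {m} {N} (twice-binomial n) conjecture Z w (p i) (p j) w≢0 p≡ (p∈Z i) (p∈Z j)
  in violates q q∈
  where
  N : ℕ
  N = suc n C 2
  N≢0 : ℕ.NonZero N
  N≢0 = ℕ.m*n≢0⇒n≢0 2 {{subst ℕ.NonZero (sym (twice-binomial n)) _}}
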